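{- Let $d\ge 4$ be an integer. There exist a constant $c_d>0$ and an integer $n_0(d)$ such that for every $n\ge n_0(d)$: if $\mathcal{F}\subseteq\binom{[n]}{d+1}$ has VC-dimension at most $d$, then $|\mathcal{F}|\le\binom{n}{d}-c_d n^{d-4}$.
   Context: $\binom{[n]}{k}$ denotes the family of all $k$-element subsets of $[n]$. A family $\mathcal{F}$ shatters $S$ if for every $A\subseteq S$ there is $F\in\mathcal{F}$ with $F\cap S=A$; the VC-dimension of $\mathcal{F}$ is the largest size of a shattered set. -}

module Defs where

open import Data.Bool.Properties using () renaming (_≟_ to _≟ᵇ_)
open import Data.Fin.Subset using (Subset; inside; outside; ⊥; _⊆_; _∩_; ∣_∣)
open import Data.Fin.Subset.Properties using (_⊆?_; ∩-zeroʳ; ⊆-antisym; ⊆-min; ∣⊥∣≡0)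
open import Data.Integer.Base using (+_)
open import Data.List.Base using (List; []; _∷_; _++_; map; filter; length)
open import Data.List.Extrema.Nat using (max; max≤v⁺; xs≤max; argmax-sel)
open import Data.List.Membership.Propositional using (_∈_; find; lose)
open import Data.List.Membership.Propositional.Properties
  using (∈-map⁺; ∈-map⁻; ∈-++⁺ˡ; ∈-++⁺ʳ; ∈-filter⁺; ∈-filter⁻)
open import Data.List.Relation.Unary.All as All using (All)
open import Data.List.Relation.Unary.Any using (here; any?)
open import Data.List.Relation.Unary.Unique.Propositional using (Unique)
open import Data.Nat.Base using (ℕ; zero; suc; _≤_; z≤n)
open import Data.Product.Base using (∃; _×_; _,_; proj₂)
open import Data.Rational.Base using (ℚ; _/_)
open import Data.Sum.Base using (inj₁; inj₂)
open import Data.Vec.Base as Vec using ()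
open import Data.Vec.Properties using (≡-dec)
open import Function.Base using (id; _∘_)
open import Relation.Binary.PropositionalEquality using (_≡_; refl; sym; trans)
open import Relation.Nullary.Decidable using (Dec; map′; _→-dec_)

private variable
  n k : ℕ

-- A list is used as a finite set, so duplicates must be excluded for
-- `length` to be the cardinality.
record Family (n k : ℕ) : Set where
  constructor family
  field
    members : List (Subset n)
    unique  : Unique members
    uniform : All (λ B → ∣ B ∣ ≡ k) members

open Family public

card : Family n k → ℕ
card = length ∘ members

Shatters : List (Subset n) → Subset n → Set
Shatters F S = ∀ A → A ⊆ S → ∃ λ B → B ∈ F × B ∩ S ≡ A

allSubsets : ∀ n → List (Subset n)
allSubsets zero    = Vec.[] ∷ []
allSubsets (suc n) =
  map (inside Vec.∷_) (allSubsets n) ++ map (outside Vec.∷_) (allSubsets n)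

∈-allSubsets : (S : Subset n) → S ∈ allSubsets n
∈-allSubsets Vec.[] = here refl
∈-allSubsets (inside Vec.∷ S) = ∈-++⁺ˡ (∈-map⁺ _ (∈-allSubsets S))
∈-allSubsets {suc n} (outside Vec.∷ S) =
  ∈-++⁺ʳ (map (inside Vec.∷_) (allSubsets n)) (∈-map⁺ _ (∈-allSubsets S))

shatters? : (F : List (Subset n)) (S : Subset n) → Dec (Shatters F S)
shatters? {n} F S =
  map′ (λ all A → All.lookup all (∈-allSubsets A)) (λ sh → All.tabulate (λ {A} _ → sh A))
    (All.all? (λ A → (A ⊆? S) →-dec trace? A) (allSubsets n))
  where
  trace? : ∀ A → Dec (∃ λ B → B ∈ F × B ∩ S ≡ A)
  trace? A = map′ find (λ (_ , B∈F , eq) → lose B∈F eq)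
    (any? (λ B → ≡-dec _≟ᵇ_ (B ∩ S) A) F)

-- The empty family shatters no set; it is given VC-dimension 0.
vcDim : List (Subset n) → ℕ
vcDim {n} F = max 0 (map ∣_∣ (filter (shatters? F) (allSubsets n)))

shattered⇒≤vcDim : (F : List (Subset n)) (S : Subset n) → Shatters F S → ∣ S ∣ ≤ vcDim F
shattered⇒≤vcDim F S sh =
  All.lookup (xs≤max 0 _) (∈-map⁺ ∣_∣ (∈-filter⁺ (shatters? F) (∈-allSubsets S) sh))

vcDim-attained : (F : List (Subset n)) {B : Subset n} → B ∈ F →
                 ∃ λ S → Shatters F S × ∣ S ∣ ≡ vcDim F
vcDim-attained {n} F {B} B∈F
  with argmax-sel id 0 (map ∣_∣ (filter (shatters? F) (allSubsets n)))
... | inj₁ max≡0 = ⊥ , ⊥-shattered , trans (∣⊥∣≡0 n) (sym max≡0)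
  where
  ⊥-shattered : Shatters F ⊥
  ⊥-shattered A A⊆⊥ = B , B∈F , trans (∩-zeroʳ B) (⊆-antisym (⊆-min A) A⊆⊥)
... | inj₂ max∈ with ∈-map⁻ ∣_∣ max∈
...   | S , S∈ , eq = S , proj₂ (∈-filter⁻ (shatters? F) {xs = allSubsets n} S∈) , sym eq

fromℕ : ℕ → ℚ
fromℕ m = + m / 1

{-# OPTIONS --safe #-}
-- Choose for each X ∈ F a trace B X missing on X.  The polynomial
--   dual X = x_X − x_{B X} ∏_{e ∈ X ∖ B X} (x_e − 1)
-- has degree at most d and equals the indicator of X on F, which gives the
-- Frankl–Pach bound |F| ≤ n C d: evaluations at the members of F are independent
-- functionals on polynomials of degree at most d.  More functionals independent
-- of these are obtained from alternating sums Δ over d disjoint pairs of vertices.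
-- They are detected by the polynomials
--   vanishing D = x_D − ∑_{D ⊆ X ∈ F} dual X,   |D| = d,
-- which are zero on F.  Every vertex set K of bounded size hosts a pair (Δ, D)
-- (up to two further vertices) with Δ (vanishing D) ≠ 0: otherwise any d-set near K
-- with two extensions to F extends by all of K, and this exchange property makes
-- some member of F shattered.  Pairs hosted by sets K, K′ with |K ∩ K′| < d − 4 are
-- orthogonal.  Graphs of integer polynomials with d − 4 coefficients below
-- q ≈ n / const provide q ^ (d − 4) such sets K.
module Submission where

open import Data.Bool.Base using (if_then_else_)
import Data.Bool.Properties as Bool
import Data.Empty as Empty
open import Data.Fin.Base using (Fin; zero; suc; punchIn; toℕ; fromℕ<; combine; finToFun; funToFin; splitAt; _↑ˡ_; _↑ʳ_; inject≤)
open import Data.Fin.Properties as Fin using (punchInᵢ≢i; toℕ<n; toℕ-injective; toℕ-fromℕ<; combine-injective; funToFin-finToFin)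
open import Data.Fin.Subset as Sub using (Subset; inside; outside; _∈_; _∉_; _⊆_; _∩_; ∣_∣; ⁅_⁆)
open import Data.Fin.Subset.Properties
open import Data.Integer.Base as ℤ using (ℤ; +_; 0ℤ; 1ℤ; -_; _+_; _*_; _-_; -1ℤ)
import Data.Integer.Properties as ℤ
open import Data.Integer.Tactic.RingSolver using (solve-∀)
open import Data.List.Base using (List; []; _∷_; length; filter; allFin; map; _++_; foldr; cartesianProduct; tabulate; lookup)
open import Data.List.Membership.Propositional as List using (find)
open import Data.List.Membership.Propositional.Properties using (∈-filter⁺; ∈-filter⁻; ∈-allFin; ∈-map⁺; ∈-map⁻; ∈-cartesianProduct⁺; ∈-cartesianProduct⁻; ∈-++⁺ˡ; ∈-++⁺ʳ; ∈-tabulate⁻; ∈-lookup)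
open import Data.List.Properties using (length-map; length-++; length-tabulate; filter-all)
open import Data.List.Relation.Unary.All as All using (All; []; _∷_)
import Data.List.Relation.Unary.All.Properties as All
open import Data.List.Relation.Unary.AllPairs using ([]; _∷_)
open import Data.List.Relation.Unary.Any as Any using (Any; here; there)
open import Data.List.Relation.Unary.Any.Properties using (lookup-index)
open import Data.List.Relation.Unary.Unique.Propositional using (Unique)
open import Data.List.Relation.Unary.Unique.Propositional.Properties as Unique using (allFin⁺; filter⁺)
open import Data.Nat.Base as ℕ using (ℕ; zero; suc; _≤_; _<_; z≤n; s≤s; _^_; _∸_)
open import Data.Nat.Combinatorics using (_C_; nCk+nC[k+1]≡[n+1]C[k+1])
open import Data.Nat.DivMod using (_/_; m/n*n≤m; m≡m%n+[m/n]*n; m%n<n; m≥n⇒m/n>0)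
import Data.Nat.Properties as ℕ
open import Data.Product.Base using (∃; _×_; _,_; proj₁; proj₂; ∃₂)
open import Data.Rational.Base as ℚ using (ℚ; 0ℚ; 1ℚ)
import Data.Rational.Properties as ℚ
open import Data.Rational.Unnormalised.Base as ℚᵘ using (mkℚᵘ; *≡*; *≤*)
import Data.Rational.Unnormalised.Properties as ℚᵘ
open import Data.Sum.Base as Sum using (_⊎_; inj₁; inj₂)
open import Data.Unit.Base using (⊤; tt)
open import Data.Vec.Base using ([]; _∷_; _[_]≔_; here; there)
open import Data.Vec.Functional using (insertAt)
open import Data.Vec.Functional.Properties using (insertAt-lookup; insertAt-punchIn)
open import Data.Vec.Properties using ([]≔-commutes; []≔-idempotent; ≡-dec)
open import Defs
open import Function.Base using (_∘_)
open import Relation.Binary.PropositionalEquality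
open import Relation.Nullary.Decidable using (Dec; yes; no; does; ¬?; _×-dec_; decidable-stable)
open import Relation.Nullary.Negation using (¬_; contradiction)
import Algebra.Properties.Semiring.Sum ℤ.+-*-semiring as Σ
open Σ using (sum)

-- The 4 in the exponent counts stray vertices. For two gadgets, `vanishing D` involves only sets X
-- with at most one vertex beyond D; D may use one vertex outside K, and the pairs of the other
-- gadget may use two vertices outside K′. An X that meets all d pairs of the other gadget therefore
-- has at least d - 4 vertices in K ∩ K′. Outside vertices enter because the extensions of a d-set
-- found by counting may lie anywhere in [n], so the exchange step must also handle d-sets with one
-- vertex outside K and a hole outside K. Counting is possible because Δ of a monomial is 1, 0 or
-- -1. Without a gadget, Δ of x_D is a sum of such terms over pairs (X, e) with D ⊆ X ∈ F and e ∈ X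
-- outside `B X`. A left side equal to 1, or a known term -1, then forces positive terms, and the
-- signs identify the members of F behind them. Graphs of polynomials over ℤ instead of a finite
-- field avoid any choice of a prime; the values stay below q times a constant (`height`).

private variable
  n : ℕ

-- Finite sets

infixl 6 _⊕_ _⊖_ _⊕*_

_⊕_ _⊖_ : Subset n → Fin n → Subset n
T ⊕ e = T [ e ]≔ inside
T ⊖ e = T [ e ]≔ outside

_⊕*_ : Subset n → List (Fin n) → Subset n
T ⊕* []       = T
T ⊕* (e ∷ es) = (T ⊕ e) ⊕* es

∈-⊕-self : (T : Subset n) (e : Fin n) → e ∈ T ⊕ e
∈-⊕-self (_ ∷ T) zero    = here
∈-⊕-self (_ ∷ T) (suc e) = there (∈-⊕-self T e)

∈-⊕⁺ : (T : Subset n) (e : Fin n) → T ⊆ T ⊕ e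
∈-⊕⁺ (_ ∷ T) zero    here      = here
∈-⊕⁺ (_ ∷ T) zero    (there p) = there p
∈-⊕⁺ (_ ∷ T) (suc e) here      = here
∈-⊕⁺ (_ ∷ T) (suc e) (there p) = there (∈-⊕⁺ T e p)

∈-⊕⁻ : (T : Subset n) (e : Fin n) {x : Fin n} → x ∈ T ⊕ e → x ≡ e ⊎ x ∈ T
∈-⊕⁻ (_ ∷ T) zero    here      = inj₁ refl
∈-⊕⁻ (_ ∷ T) zero    (there p) = inj₂ (there p)
∈-⊕⁻ (_ ∷ T) (suc e) here      = inj₂ here
∈-⊕⁻ (_ ∷ T) (suc e) (there p) = Sum.map (cong suc) there (∈-⊕⁻ T e p)

∉-⊕ : (T : Subset n) {e x : Fin n} → x ≢ e → x ∉ T → x ∉ T ⊕ e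
∉-⊕ T x≢e x∉T x∈ = Sum.[ x≢e , x∉T ] (∈-⊕⁻ T _ x∈)

∉-⊕⁻ : (T : Subset n) {e x : Fin n} → x ∉ T ⊕ e → x ≢ e × x ∉ T
∉-⊕⁻ T {e} x∉ = (λ { refl → x∉ (∈-⊕-self T e) }) , (λ x∈ → x∉ (∈-⊕⁺ T e x∈))

⊕-mono : (T : Subset n) {e : Fin n} {S : Subset n} → T ⊆ S → T ⊕ e ⊆ S ⊕ e
⊕-mono T {e} {S} T⊆S x∈ with ∈-⊕⁻ T e x∈
... | inj₁ refl = ∈-⊕-self S e
... | inj₂ x∈T  = ∈-⊕⁺ S e (T⊆S x∈T)

⊕-⊆ : (T : Subset n) {e : Fin n} {S : Subset n} → e ∈ S → T ⊆ S → T ⊕ e ⊆ S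
⊕-⊆ T {e} e∈S T⊆S x∈ with ∈-⊕⁻ T e x∈
... | inj₁ refl = e∈S
... | inj₂ x∈T  = T⊆S x∈T

∉-⊖-self : (T : Subset n) (e : Fin n) → e ∉ T ⊖ e
∉-⊖-self (_ ∷ T) (suc e) (there p) = ∉-⊖-self T e p

∈-⊖⁺ : (T : Subset n) {e x : Fin n} → x ≢ e → x ∈ T → x ∈ T ⊖ e
∈-⊖⁺ (_ ∷ T) {zero}  x≢e here      = contradiction refl x≢e
∈-⊖⁺ (_ ∷ T) {zero}  x≢e (there p) = there p
∈-⊖⁺ (_ ∷ T) {suc e} x≢e here      = here
∈-⊖⁺ (_ ∷ T) {suc e} x≢e (there p) = there (∈-⊖⁺ T (x≢e ∘ cong suc) p)

⊖⊆ : (T : Subset n) (e : Fin n) → T ⊖ e ⊆ T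
⊖⊆ (_ ∷ T) zero    (there p) = there p
⊖⊆ (_ ∷ T) (suc e) here      = here
⊖⊆ (_ ∷ T) (suc e) (there p) = there (⊖⊆ T e p)

∈-⊖⁻ : (T : Subset n) {e x : Fin n} → x ∈ T ⊖ e → x ≢ e
∈-⊖⁻ T x∈ refl = ∉-⊖-self T _ x∈

⊕-comm : (T : Subset n) (e f : Fin n) → T ⊕ e ⊕ f ≡ T ⊕ f ⊕ e
⊕-comm T e f with e Fin.≟ f
... | yes refl = refl
... | no  e≢f  = []≔-commutes T e f e≢f

⊕-∈ : (T : Subset n) {e : Fin n} → e ∈ T → T ⊕ e ≡ T
⊕-∈ T e∈T = ⊆-antisym (⊕-⊆ T e∈T (λ x∈ → x∈)) (∈-⊕⁺ T _)

⊖-⊕ : (T : Subset n) {e : Fin n} → e ∈ T → T ⊖ e ⊕ e ≡ T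
⊖-⊕ T {e} e∈T = trans ([]≔-idempotent T e) (⊕-∈ T e∈T)

⊕-⊖ : (T : Subset n) {e : Fin n} → e ∉ T → T ⊕ e ⊖ e ≡ T
⊕-⊖ T {e} e∉T = ⊆-antisym
  (λ x∈ → Sum.[ (λ x≡e → contradiction x≡e (∈-⊖⁻ (T ⊕ e) x∈)) , (λ x∈T → x∈T) ] (∈-⊕⁻ T e (⊖⊆ (T ⊕ e) e x∈)))
  (λ x∈T → ∈-⊖⁺ (T ⊕ e) (λ { refl → e∉T x∈T }) (∈-⊕⁺ T e x∈T))

∣⊕∣ : (T : Subset n) {e : Fin n} → e ∉ T → ∣ T ⊕ e ∣ ≡ suc ∣ T ∣
∣⊕∣ (inside  ∷ T) {zero}  e∉T = contradiction here e∉T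
∣⊕∣ (outside ∷ T) {zero}  e∉T = refl
∣⊕∣ (inside  ∷ T) {suc e} e∉T = cong suc (∣⊕∣ T (e∉T ∘ there))
∣⊕∣ (outside ∷ T) {suc e} e∉T = ∣⊕∣ T (e∉T ∘ there)

∣⊕∣≤ : (T : Subset n) (e : Fin n) → ∣ T ⊕ e ∣ ≤ suc ∣ T ∣
∣⊕∣≤ T e with e ∈? T
... | yes e∈T = ℕ.≤-trans (ℕ.≤-reflexive (cong ∣_∣ (⊕-∈ T e∈T))) (ℕ.n≤1+n _)
... | no  e∉T = ℕ.≤-reflexive (∣⊕∣ T e∉T)

∣⊖∣ : (T : Subset n) {e : Fin n} → e ∈ T → suc ∣ T ⊖ e ∣ ≡ ∣ T ∣
∣⊖∣ T {e} e∈T = trans (sym (∣⊕∣ (T ⊖ e) (∉-⊖-self T e))) (cong ∣_∣ (⊖-⊕ T e∈T))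

⊆-∣∣-≡ : {p q : Subset n} → p ⊆ q → ∣ q ∣ ≤ ∣ p ∣ → p ≡ q
⊆-∣∣-≡ {p = p} {q} p⊆q q≤p with q ⊆? p
... | yes q⊆p = ⊆-antisym p⊆q q⊆p
... | no  q⊈p with Fin.any? (λ x → (x ∈? q) ×-dec ¬? (x ∈? p))
...   | yes (x , x∈q , x∉p) = contradiction (p⊂q⇒∣p∣<∣q∣ (p⊆q , x , x∈q , x∉p)) (ℕ.≤⇒≯ q≤p)
...   | no  none = contradiction (λ {x} x∈q → decidable-stable (x ∈? p) (λ x∉p → none (x , x∈q , x∉p))) q⊈p

⊈⇒∃ : (p q : Subset n) → ¬ p ⊆ q → ∃ λ x → x ∈ p × x ∉ q
⊈⇒∃ p q p⊈q with Fin.any? (λ x → (x ∈? p) ×-dec ¬? (x ∈? q))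
... | yes ∃x = ∃x
... | no  none = contradiction (λ {x} x∈p → decidable-stable (x ∈? q) (λ x∉q → none (x , x∈p , x∉q))) p⊈q

∃∉ : (p q : Subset n) → ∣ q ∣ < ∣ p ∣ → ∃ λ x → x ∈ p × x ∉ q
∃∉ p q q<p = ⊈⇒∃ p q λ p⊆q → ℕ.<⇒≱ q<p (p⊆q⇒∣p∣≤∣q∣ p⊆q)

⊕*-comm : (T : Subset n) (e : Fin n) (es : List (Fin n)) → (T ⊕ e) ⊕* es ≡ (T ⊕* es) ⊕ e
⊕*-comm T e []       = refl
⊕*-comm T e (f ∷ es) = trans (cong (_⊕* es) (⊕-comm T e f)) (⊕*-comm (T ⊕ f) e es)

∈-⊕*⁻ : (T : Subset n) (es : List (Fin n)) {x : Fin n} → x ∈ T ⊕* es → x ∈ T ⊎ x List.∈ es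
∈-⊕*⁻ T []       x∈ = inj₁ x∈
∈-⊕*⁻ T (e ∷ es) x∈ with ∈-⊕*⁻ (T ⊕ e) es x∈
... | inj₂ x∈es = inj₂ (there x∈es)
... | inj₁ x∈T⊕e = Sum.[ (λ x≡e → inj₂ (here x≡e)) , inj₁ ] (∈-⊕⁻ T e x∈T⊕e)

⊆-⊕* : (T : Subset n) (es : List (Fin n)) → T ⊆ T ⊕* es
⊆-⊕* T []       x∈ = x∈
⊆-⊕* T (e ∷ es) x∈ = ⊆-⊕* (T ⊕ e) es (∈-⊕⁺ T e x∈)

∈-⊕*⁺ : (T : Subset n) {es : List (Fin n)} {x : Fin n} → x List.∈ es → x ∈ T ⊕* es
∈-⊕*⁺ T {e ∷ es} (here refl) = ⊆-⊕* (T ⊕ e) es (∈-⊕-self T e)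
∈-⊕*⁺ T {e ∷ es} (there x∈)  = ∈-⊕*⁺ (T ⊕ e) x∈

∣⊕*∣ : (T : Subset n) {es : List (Fin n)} → Unique es → All (_∉ T) es → ∣ T ⊕* es ∣ ≡ ∣ T ∣ ℕ.+ length es
∣⊕*∣ T [] [] = sym (ℕ.+-identityʳ _)
∣⊕*∣ T {e ∷ es} (e∉es ∷ u) (e∉T ∷ es∉T) = trans
  (∣⊕*∣ (T ⊕ e) u (All.zipWith (λ (e≢x , x∉T) → ∉-⊕ T (e≢x ∘ sym) x∉T) (e∉es , es∉T)))
  (trans (cong (ℕ._+ length es) (∣⊕∣ T e∉T)) (sym (ℕ.+-suc ∣ T ∣ (length es))))

module _ {P : Fin n → Set} (P? : ∀ x → Dec (P x)) where

  select : List (Fin n)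
  select = filter P? (allFin n)

  select-unique : Unique select
  select-unique = filter⁺ P? (allFin⁺ n)

  ∈-select⁺ : ∀ {x} → P x → x List.∈ select
  ∈-select⁺ Px = ∈-filter⁺ P? (∈-allFin _) Px

  ∈-select⁻ : ∀ {x} → x List.∈ select → P x
  ∈-select⁻ x∈ = proj₂ (∈-filter⁻ P? {xs = allFin n} x∈)

elements : Subset n → List (Fin n)
elements S = select (_∈? S)

∣elements∣ : (S : Subset n) → length (elements S) ≡ ∣ S ∣
∣elements∣ {n} S = sym (trans (cong ∣_∣ S≡) (trans
  (∣⊕*∣ Sub.⊥ (select-unique (_∈? S)) (All.tabulate (λ _ → ∉⊥)))
  (cong (ℕ._+ length (elements S)) (∣⊥∣≡0 n))))
  where
  S≡ : S ≡ Sub.⊥ ⊕* elements S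
  S≡ = ⊆-antisym (λ x∈ → ∈-⊕*⁺ Sub.⊥ (∈-select⁺ (_∈? S) x∈))
    (λ x∈ → Sum.[ (λ x∈⊥ → contradiction x∈⊥ ∉⊥) , ∈-select⁻ (_∈? S) ] (∈-⊕*⁻ Sub.⊥ (elements S) x∈))

unique-⊆⇒length≤ : (S : Subset n) {zs : List (Fin n)} → Unique zs → All (_∈ S) zs → length zs ≤ ∣ S ∣
unique-⊆⇒length≤ S [] [] = z≤n
unique-⊆⇒length≤ S {z ∷ zs} (z∉zs ∷ u) (z∈S ∷ zs∈S) = ℕ.≤-trans
  (s≤s (unique-⊆⇒length≤ (S ⊖ z) u (All.zipWith (λ (z≢x , x∈S) → ∈-⊖⁺ S (z≢x ∘ sym) x∈S) (z∉zs , zs∈S))))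
  (ℕ.≤-reflexive (∣⊖∣ S z∈S))

-- Indicators and monomials

⟦_⟧ : {P : Set} → Dec P → ℤ
⟦ P? ⟧ = if does P? then 1ℤ else 0ℤ

⟦⟧-yes : {P : Set} (P? : Dec P) → P → ⟦ P? ⟧ ≡ 1ℤ
⟦⟧-yes (yes _) p = refl
⟦⟧-yes (no ¬p) p = contradiction p ¬p

⟦⟧-no : {P : Set} (P? : Dec P) → ¬ P → ⟦ P? ⟧ ≡ 0ℤ
⟦⟧-no (yes p) ¬p = contradiction p ¬p
⟦⟧-no (no _)  ¬p = refl

⟦⟧-cong : {P Q : Set} (P? : Dec P) (Q? : Dec Q) → (P → Q) → (Q → P) → ⟦ P? ⟧ ≡ ⟦ Q? ⟧
⟦⟧-cong (yes p) Q? f g = sym (⟦⟧-yes Q? (f p))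
⟦⟧-cong (no ¬p) Q? f g = sym (⟦⟧-no Q? (¬p ∘ g))

χ : Subset n → Fin n → ℤ
χ T e = ⟦ e ∈? T ⟧

mono : Subset n → Subset n → ℤ
mono T X = ⟦ T ⊆? X ⟧

-- Linear algebra over ℤ

sum-zero : ∀ {n} {f : Fin n → ℤ} → (∀ i → f i ≡ 0ℤ) → sum f ≡ 0ℤ
sum-zero {n} f≡0 = trans (Σ.sum-cong-≗ f≡0) (Σ.sum-replicate-zero n)

sum-single : ∀ {n} {f : Fin n → ℤ} (i : Fin n) → (∀ j → j ≢ i → f j ≡ 0ℤ) → sum f ≡ f i
sum-single {suc n} {f} i f≡0 = trans (Σ.sum-remove {i = i} f)
  (trans (cong (_+_ (f i)) (sum-zero (λ j → f≡0 (punchIn i j) (punchInᵢ≢i i j)))) (ℤ.+-identityʳ (f i)))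

-- Fraction-free Gaussian elimination: a nonzero pivot `a` clears its column by
-- cross-multiplication, so the solution stays integral.
homogeneous-solution : ∀ {m k} (A : Fin m → Fin k → ℤ) → m < k →
  ∃ λ (x : Fin k → ℤ) → (∃ λ j → x j ≢ 0ℤ) × (∀ i → sum (λ j → A i j * x j) ≡ 0ℤ)
homogeneous-solution {zero}  {suc k} A m<k = (λ _ → 1ℤ) , (zero , λ ()) , λ ()
homogeneous-solution {suc m} {suc k} A (s≤s m<k) with Fin.all? (λ j → A zero j ℤ.≟ 0ℤ)
... | yes row≡0 with homogeneous-solution (A ∘ suc) (ℕ.m<n⇒m<1+n m<k)
...   | x , x≢0 , sol = x , x≢0 , λ
  { zero    → sum-zero (λ j → trans (cong (_* x j) (row≡0 j)) (ℤ.*-zeroˡ (x j)))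
  ; (suc i) → sol i }
homogeneous-solution {suc m} {suc k} A (s≤s m<k) | no row≢0
  with Fin.¬∀⟶∃¬ (suc k) _ (λ j → A zero j ℤ.≟ 0ℤ) row≢0
... | p , a≢0 with homogeneous-solution
      (λ i j → A zero p * A (suc i) (punchIn p j) - A (suc i) p * A zero (punchIn p j)) m<k
...   | y , (j₀ , y≢0) , sol = x , (punchIn p j₀ , x≢0) , solves
  where
  a = A zero p
  r : Fin k → ℤ
  r j = A zero (punchIn p j)
  x : Fin (suc k) → ℤ
  -- Scaling `y` by the pivot lets the entry at `p` solve row zero without division; `x` remains
  -- nonzero because ℤ has no zero divisors.
  x = insertAt (λ j → a * y j) p (- sum (λ j → r j * y j))
  x≢0 : x (punchIn p j₀) ≢ 0ℤ
  x≢0 eq with ℤ.i*j≡0⇒i≡0∨j≡0 a (trans (sym (insertAt-punchIn _ p _ j₀)) eq)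
  ... | inj₁ a≡0 = a≢0 a≡0
  ... | inj₂ y≡0 = y≢0 y≡0
  split : ∀ i → sum (λ j → A i j * x j) ≡
          A i p * - sum (λ j → r j * y j) + sum (λ j → A i (punchIn p j) * (a * y j))
  split i = trans (Σ.sum-remove {i = p} (λ j → A i j * x j)) (cong₂ _+_
    (cong (A i p *_) (insertAt-lookup (λ j → a * y j) p _))
    (Σ.sum-cong-≗ (λ j → cong (A i (punchIn p j) *_) (insertAt-punchIn (λ j → a * y j) p _ j))))
  eliminate : ∀ i → sum (λ j → A i j * x j) ≡
              sum (λ j → (a * A i (punchIn p j) - A i p * r j) * y j)
  eliminate i = begin
    sum (λ j → A i j * x j)
      ≡⟨ split i ⟩
    A i p * - sum (λ j → r j * y j) + sum (λ j → A i (punchIn p j) * (a * y j))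
      ≡⟨ cong (_+ rest) (neg (A i p) (sum (λ j → r j * y j))) ⟩
    - A i p * sum (λ j → r j * y j) + sum (λ j → A i (punchIn p j) * (a * y j))
      ≡⟨ cong (_+ rest) (Σ.*-distribˡ-sum (- A i p) (λ j → r j * y j)) ⟩
    sum (λ j → - A i p * (r j * y j)) + sum (λ j → A i (punchIn p j) * (a * y j))
      ≡⟨ Σ.∑-distrib-+ (λ j → - A i p * (r j * y j)) (λ j → A i (punchIn p j) * (a * y j)) ⟨
    sum (λ j → - A i p * (r j * y j) + A i (punchIn p j) * (a * y j))
      ≡⟨ Σ.sum-cong-≗ (λ j → rearrange (A i p) (r j) (y j) (A i (punchIn p j)) a) ⟩
    sum (λ j → (a * A i (punchIn p j) - A i p * r j) * y j) ∎
    where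
    open ≡-Reasoning
    rest = sum (λ j → A i (punchIn p j) * (a * y j))
    neg : ∀ b s → b * - s ≡ - b * s
    neg = solve-∀
    rearrange : ∀ b r y c a → - b * (r * y) + c * (a * y) ≡ (a * c - b * r) * y
    rearrange = solve-∀
  solves : ∀ i → sum (λ j → A i j * x j) ≡ 0ℤ
  solves zero    = trans (eliminate zero) (sum-zero (λ j → cancel a (r j) (y j)))
    where
    cancel : ∀ a r y → (a * r - a * r) * y ≡ 0ℤ
    cancel = solve-∀
  solves (suc i) = trans (eliminate (suc i)) (sol i)

-- Integer polynomials with few common values

eval : ∀ {r} → (Fin r → ℤ) → ℤ → ℤ
eval {zero}  c x = 0ℤ
eval {suc r} c x = c zero + x * eval (c ∘ suc) x

-- The partial values of Horner's scheme at a, which are also the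
-- coefficients of the quotient by x - a.
horner : ∀ {r} → ℤ → (Fin r → ℤ) → Fin r → ℤ
horner a c zero    = eval c a
horner a c (suc i) = horner a (c ∘ suc) i

eval-horner : ∀ {r} (c : Fin (suc r) → ℤ) a x →
  eval c x - eval c a ≡ (x - a) * eval (horner a (c ∘ suc)) x
eval-horner {zero} c a x = identity (c zero) a x
  where
  identity : ∀ c a x → (c + x * 0ℤ) - (c + a * 0ℤ) ≡ (x - a) * 0ℤ
  identity = solve-∀
eval-horner {suc r} c a x = begin
  (c zero + x * ex) - (c zero + a * ea)  ≡⟨ expand (c zero) x a ex ea ⟩
  x * (ex - ea) + (x - a) * ea           ≡⟨ cong (λ t → x * t + (x - a) * ea) (eval-horner (c ∘ suc) a x) ⟩
  x * ((x - a) * h) + (x - a) * ea       ≡⟨ collect x a h ea ⟩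
  (x - a) * (ea + x * h)                 ∎
  where
  open ≡-Reasoning
  ex = eval (c ∘ suc) x
  ea = eval (c ∘ suc) a
  h = eval (horner a (λ j → c (suc (suc j)))) x
  expand : ∀ c x a ex ea → (c + x * ex) - (c + a * ea) ≡ x * (ex - ea) + (x - a) * ea
  expand = solve-∀
  collect : ∀ x a h ea → x * ((x - a) * h) + (x - a) * ea ≡ (x - a) * (ea + x * h)
  collect = solve-∀

-- Each coefficient is a Horner value minus `a` times the next one, so the scheme can be inverted.
horner≡0 : ∀ {r} (c : Fin r → ℤ) a → (∀ j → horner a c j ≡ 0ℤ) → ∀ j → c j ≡ 0ℤ
horner≡0 {suc zero} c a h≡0 zero = trans (identity (c zero) a) (h≡0 zero)
  where
  identity : ∀ c a → c ≡ c + a * 0ℤ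
  identity = solve-∀
horner≡0 {suc (suc r)} c a h≡0 zero = begin
  c zero                               ≡⟨ identity (c zero) a ⟩
  c zero + a * 0ℤ                      ≡⟨ cong (λ t → c zero + a * t) (h≡0 (suc zero)) ⟨
  eval c a                             ≡⟨ h≡0 zero ⟩
  0ℤ                                   ∎
  where
  open ≡-Reasoning
  identity : ∀ c a → c ≡ c + a * 0ℤ
  identity = solve-∀
horner≡0 {suc r} c a h≡0 (suc j) = horner≡0 (c ∘ suc) a (h≡0 ∘ suc) j

-- Splitting off the root `a` leaves a quotient with one coefficient fewer, and the other roots,
-- being distinct from `a`, are roots of it.
roots⇒zero : ∀ {r} (c : Fin r → ℤ) {as : List ℤ} → Unique as → r ≤ length as →
             All (λ a → eval c a ≡ 0ℤ) as → ∀ j → c j ≡ 0ℤ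
roots⇒zero {suc r} c {a ∷ as} (a∉as ∷ u) (s≤s r≤) (ca≡0 ∷ cas≡0) =
  horner≡0 c a λ
    { zero    → ca≡0
    ; (suc j) → roots⇒zero (horner a (c ∘ suc)) u r≤ (All.zipWith root (a∉as , cas≡0)) j }
  where
  root : ∀ {x} → a ≢ x × eval c x ≡ 0ℤ → eval (horner a (c ∘ suc)) x ≡ 0ℤ
  root {x} (a≢x , cx≡0) with ℤ.i*j≡0⇒i≡0∨j≡0 (x - a)
    (trans (sym (eval-horner c a x)) (cong₂ _-_ cx≡0 ca≡0))
  ... | inj₁ x-a≡0 = contradiction (sym (ℤ.i-j≡0⇒i≡j x a x-a≡0)) a≢x
  ... | inj₂ eq    = eq

evalℕ : ∀ {r} → (Fin r → ℕ) → ℕ → ℕ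
evalℕ {zero}  w x = 0
evalℕ {suc r} w x = w zero ℕ.+ x ℕ.* evalℕ (w ∘ suc) x

eval-difference : ∀ {r} (v w : Fin r → ℕ) x →
  eval (λ j → + v j - + w j) (+ x) ≡ + evalℕ v x - + evalℕ w x
eval-difference {zero}  v w x = refl
eval-difference {suc r} v w x = begin
  (+ v zero - + w zero) + + x * eval (λ j → + v (suc j) - + w (suc j)) (+ x)
    ≡⟨ cong (λ t → (+ v zero - + w zero) + + x * t) (eval-difference (v ∘ suc) (w ∘ suc) x) ⟩
  (+ v zero - + w zero) + + x * (+ V - + W)
    ≡⟨ identity (+ v zero) (+ w zero) (+ x) (+ V) (+ W) ⟩
  (+ v zero + + x * + V) - (+ w zero + + x * + W)
    ≡⟨ cong₂ (λ s t → (+ v zero + s) - (+ w zero + t)) (sym (ℤ.pos-* x V)) (sym (ℤ.pos-* x W)) ⟩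
  + evalℕ v x - + evalℕ w x ∎
  where
  open ≡-Reasoning
  V = evalℕ (v ∘ suc) x
  W = evalℕ (w ∘ suc) x
  identity : ∀ a b x v w → (a - b) + x * (v - w) ≡ (a + x * v) - (b + x * w)
  identity = solve-∀

-- The geometric sum 1 + m + ... + m^r. The value 1 at r = 0 keeps `evalℕ<height` strict for the
-- empty polynomial.
height : ℕ → ℕ → ℕ
height m zero    = 1
height m (suc r) = suc (m ℕ.* height m r)

evalℕ<height : ∀ {r m q} (w : Fin r → ℕ) x → 0 < q → (∀ j → w j < q) → x ≤ m →
               evalℕ w x < q ℕ.* height m r
evalℕ<height {zero} {m} {q} w x 0<q w<q x≤m = subst (0 <_) (sym (ℕ.*-identityʳ q)) 0<q
evalℕ<height {suc r} {m} {q} w x 0<q w<q x≤m = begin-strict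
  w zero ℕ.+ x ℕ.* evalℕ (w ∘ suc) x  <⟨ ℕ.+-mono-<-≤ (w<q zero) (ℕ.*-mono-≤ x≤m (ℕ.<⇒≤ (evalℕ<height (w ∘ suc) x 0<q (w<q ∘ suc) x≤m))) ⟩
  q ℕ.+ m ℕ.* (q ℕ.* h)               ≡⟨ cong (q ℕ.+_) (trans (sym (ℕ.*-assoc m q h)) (trans (cong (ℕ._* h) (ℕ.*-comm m q)) (ℕ.*-assoc q m h))) ⟩
  q ℕ.+ q ℕ.* (m ℕ.* h)               ≡⟨ ℕ.*-suc q (m ℕ.* h) ⟨
  q ℕ.* suc (m ℕ.* h)                 ∎
  where
  open ℕ.≤-Reasoning
  h = height m r

funToFin-cong : ∀ {r q} {f g : Fin r → Fin q} → (∀ j → f j ≡ g j) → funToFin f ≡ funToFin g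
funToFin-cong {zero}  f≗g = refl
funToFin-cong {suc r} f≗g = cong₂ combine (f≗g zero) (funToFin-cong (f≗g ∘ suc))

module _ {m r q : ℕ} (0<q : 0 < q) where

  coefficient : Fin (q ^ r) → Fin r → ℕ
  coefficient w j = toℕ (finToFun {q} {r} w j)

  vertex-bound : (w : Fin (q ^ r)) (i : Fin m) → evalℕ (coefficient w) (toℕ i) < q ℕ.* height m r
  vertex-bound w i = evalℕ<height (coefficient w) (toℕ i) 0<q (λ j → toℕ<n _) (ℕ.<⇒≤ (toℕ<n i))

  -- The point (i, w(i)) on the graph of the polynomial with coefficients `w`: a Reed-Solomon code
  -- over the integers. The encoding lets i be read off.
  vertex : Fin (q ^ r) → Fin m → Fin (m ℕ.* (q ℕ.* height m r))
  vertex w i = combine i (fromℕ< (vertex-bound w i))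

  vertex-injective : ∀ v w {i j} → vertex v i ≡ vertex w j → i ≡ j
  vertex-injective v w {i} {j} eq = proj₁ (combine-injective i _ j _ eq)

  -- Agreement at `r` indices gives `r` roots of the difference, which has only `r` coefficients.
  vertex-agree : ∀ v w {is : List (Fin m)} → Unique is → r ≤ length is →
                 All (λ i → vertex v i ≡ vertex w i) is → v ≡ w
  vertex-agree v w {is} u r≤ agree = trans (sym (funToFin-finToFin {r} {q} v))
    (trans (funToFin-cong same) (funToFin-finToFin {r} {q} w))
    where
    same : ∀ j → finToFun {q} {r} v j ≡ finToFun {q} {r} w j
    same j = toℕ-injective (ℤ.+-injective (ℤ.i-j≡0⇒i≡j _ _ (roots⇒zero
      (λ j → + coefficient v j - + coefficient w j)
      (Unique.map⁺ (toℕ-injective ∘ ℤ.+-injective) u)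
      (ℕ.≤-trans r≤ (ℕ.≤-reflexive (sym (length-map (λ i → + toℕ i) is))))
      (All.map⁺ (All.map root agree)) j)))
      where
      root : ∀ {i} → vertex v i ≡ vertex w i →
             eval (λ j → + coefficient v j - + coefficient w j) (+ toℕ i) ≡ 0ℤ
      root {i} eq = trans (eval-difference (coefficient v) (coefficient w) (toℕ i))
        (ℤ.i≡j⇒i-j≡0 (cong +_ (begin
          evalℕ (coefficient v) (toℕ i)  ≡⟨ toℕ-fromℕ< (vertex-bound v i) ⟨
          toℕ (fromℕ< (vertex-bound v i)) ≡⟨ cong toℕ (proj₂ (combine-injective i _ i _ eq)) ⟩
          toℕ (fromℕ< (vertex-bound w i)) ≡⟨ toℕ-fromℕ< (vertex-bound w i) ⟩
          evalℕ (coefficient w) (toℕ i)  ∎)))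
        where open ≡-Reasoning

-- Polynomials on a slice of the cube

∑ : {A : Set} → List A → (A → ℤ) → ℤ
∑ xs f = foldr (λ x s → f x + s) 0ℤ xs

∏ : {A : Set} → List A → (A → ℤ) → ℤ
∏ xs f = foldr (λ x s → f x * s) 1ℤ xs

module _ {A : Set} where

  ∑-cong : (xs : List A) {f g : A → ℤ} → (∀ {x} → x List.∈ xs → f x ≡ g x) → ∑ xs f ≡ ∑ xs g
  ∑-cong []       f≗g = refl
  ∑-cong (x ∷ xs) f≗g = cong₂ _+_ (f≗g (here refl)) (∑-cong xs (f≗g ∘ there))

  ∑-zero : (xs : List A) {f : A → ℤ} → (∀ {x} → x List.∈ xs → f x ≡ 0ℤ) → ∑ xs f ≡ 0ℤ
  ∑-zero []       f≡0 = refl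
  ∑-zero (x ∷ xs) f≡0 = cong₂ _+_ (f≡0 (here refl)) (∑-zero xs (f≡0 ∘ there))

  ∑-single : {xs : List A} {f : A → ℤ} {x : A} → Unique xs → x List.∈ xs →
             (∀ {y} → y List.∈ xs → y ≢ x → f y ≡ 0ℤ) → ∑ xs f ≡ f x
  ∑-single {x ∷ xs} {f} (x∉xs ∷ _) (here refl) f≡0 = trans
    (cong (_+_ (f x)) (∑-zero xs (λ y∈ → f≡0 (there y∈) (λ y≡x → All.lookup x∉xs y∈ (sym y≡x)))))
    (ℤ.+-identityʳ (f x))
  ∑-single {y ∷ xs} (y∉xs ∷ u) (there x∈) f≡0 = trans
    (cong₂ _+_ (f≡0 (here refl) (All.lookup y∉xs x∈)) (∑-single u x∈ (f≡0 ∘ there)))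
    (ℤ.+-identityˡ _)

  ∑-*ˡ : (xs : List A) (c : ℤ) (f : A → ℤ) → c * ∑ xs f ≡ ∑ xs (λ x → c * f x)
  ∑-*ˡ []       c f = ℤ.*-zeroʳ c
  ∑-*ˡ (x ∷ xs) c f = trans (ℤ.*-distribˡ-+ c (f x) (∑ xs f)) (cong (_+_ (c * f x)) (∑-*ˡ xs c f))

  ∑-++ : (xs ys : List A) (f : A → ℤ) → ∑ (xs ++ ys) f ≡ ∑ xs f + ∑ ys f
  ∑-++ []       ys f = sym (ℤ.+-identityˡ _)
  ∑-++ (x ∷ xs) ys f = trans (cong (_+_ (f x)) (∑-++ xs ys f)) (sym (ℤ.+-assoc (f x) (∑ xs f) (∑ ys f)))

  ∑-filter : {P : A → Set} (P? : ∀ x → Dec (P x)) (xs : List A) (f : A → ℤ) →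
             ∑ (filter P? xs) f ≡ ∑ xs (λ x → ⟦ P? x ⟧ * f x)
  ∑-filter P? []       f = refl
  ∑-filter P? (x ∷ xs) f with P? x
  ... | yes _ = cong₂ _+_ (sym (ℤ.*-identityˡ (f x))) (∑-filter P? xs f)
  ... | no  _ = trans (∑-filter P? xs f) (trans (sym (ℤ.+-identityˡ _)) (cong (_+ ∑ xs (λ x → ⟦ P? x ⟧ * f x)) (sym (ℤ.*-zeroˡ (f x)))))

  positives : List A → (A → ℤ) → List A
  positives xs f = filter (λ x → 0ℤ ℤ.<? f x) xs

  -- Terms of size at most 1 turn the value of a sum into a lower bound on the number of its
  -- positive terms.
  ∑≤positives : (xs : List A) {f : A → ℤ} → (∀ x → f x ℤ.≤ 1ℤ) → ∑ xs f ℤ.≤ + length (positives xs f)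
  ∑≤positives []       f≤1 = ℤ.≤-refl
  ∑≤positives (x ∷ xs) {f} f≤1 with 0ℤ ℤ.<? f x
  ... | yes _  = ℤ.+-mono-≤ (f≤1 x) (∑≤positives xs f≤1)
  ... | no 0≮f = ℤ.+-mono-≤ (ℤ.≮⇒≥ 0≮f) (∑≤positives xs f≤1)

  -- The term -1 is not merely dropped but lowers the sum, so the bound becomes strict; this yields
  -- one positive term more.
  ∑<positives : {xs : List A} {f : A → ℤ} → (∀ x → f x ℤ.≤ 1ℤ) → {x : A} → x List.∈ xs → f x ≡ -1ℤ →
                ∑ xs f ℤ.< + length (positives xs f)
  ∑<positives {x ∷ xs} {f} f≤1 (here refl) fx≡-1 with 0ℤ ℤ.<? f x
  ... | yes 0<f = contradiction (subst (0ℤ ℤ.<_) fx≡-1 0<f) (λ ())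
  ... | no _ rewrite fx≡-1 = ℤ.+-mono-<-≤ ℤ.-<+ (∑≤positives xs f≤1)
  ∑<positives {y ∷ xs} {f} f≤1 (there x∈) fx≡-1 with 0ℤ ℤ.<? f y
  ... | yes _  = ℤ.+-mono-≤-< (f≤1 y) (∑<positives f≤1 x∈ fx≡-1)
  ... | no 0≮f = ℤ.+-mono-≤-< (ℤ.≮⇒≥ 0≮f) (∑<positives f≤1 x∈ fx≡-1)

  module _ {xs : List A} {f : A → ℤ} (f≤1 : ∀ x → f x ℤ.≤ 1ℤ) where

    private
      positive : ∀ {x} → x List.∈ positives xs f → x List.∈ xs × 0ℤ ℤ.< f x
      positive = ∈-filter⁻ (λ x → 0ℤ ℤ.<? f x) {xs = xs}

      nonempty : 0 < length (positives xs f) → ∃ λ x → x List.∈ xs × 0ℤ ℤ.< f x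
      nonempty with positives xs f | positive
      ... | x ∷ _ | pos = λ _ → x , pos (here refl)

    positive-term : ∑ xs f ≡ 1ℤ → ∃ λ x → x List.∈ xs × 0ℤ ℤ.< f x
    positive-term ∑≡1 = nonempty (ℤ.drop‿+≤+ (subst (ℤ._≤ + length (positives xs f)) ∑≡1 (∑≤positives xs f≤1)))

    compensating-term : ∀ {x} → x List.∈ xs → f x ≡ -1ℤ → ∑ xs f ≡ 0ℤ → ∃ λ x → x List.∈ xs × 0ℤ ℤ.< f x
    compensating-term x∈ fx≡-1 ∑≡0 = nonempty (ℤ.drop‿+<+ (subst (ℤ._< + length (positives xs f)) ∑≡0 (∑<positives f≤1 x∈ fx≡-1)))

    two-positive-terms : ∀ {x} → Unique xs → x List.∈ xs → f x ≡ -1ℤ → ∑ xs f ≡ 1ℤ →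
      ∃₂ λ x y → x ≢ y × (x List.∈ xs × 0ℤ ℤ.< f x) × (y List.∈ xs × 0ℤ ℤ.< f y)
    two-positive-terms u x∈ fx≡-1 ∑≡1
      with positives xs f | positive | filter⁺ (λ x → 0ℤ ℤ.<? f x) u
         | ℤ.drop‿+<+ (subst (ℤ._< + length (positives xs f)) ∑≡1 (∑<positives f≤1 x∈ fx≡-1))
    ... | _ ∷ []    | _   | _               | s≤s ()
    ... | x ∷ y ∷ _ | pos | (x≢y ∷ _) ∷ _ | _ = x , y , x≢y , pos (here refl) , pos (there (here refl))

∑-map : {A B : Set} (g : A → B) (xs : List A) (f : B → ℤ) → ∑ (map g xs) f ≡ ∑ xs (f ∘ g)
∑-map g []       f = refl
∑-map g (x ∷ xs) f = cong (_+_ (f (g x))) (∑-map g xs f)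

∑-cartesianProduct : {A B : Set} (xs : List A) (ys : List B) (f : A × B → ℤ) →
  ∑ (cartesianProduct xs ys) f ≡ ∑ xs (λ x → ∑ ys (λ y → f (x , y)))
∑-cartesianProduct []       ys f = refl
∑-cartesianProduct (x ∷ xs) ys f = trans (∑-++ (map (x ,_) ys) (cartesianProduct xs ys) f)
  (cong₂ _+_ (∑-map (x ,_) ys f) (∑-cartesianProduct xs ys f))

-- Monomials and linear functionals on a slice

sum-χ : (X : Subset n) → sum (χ X) ≡ + ∣ X ∣
sum-χ []            = refl
sum-χ (inside  ∷ X) = cong (_+_ (1ℤ)) (sum-χ X)
sum-χ (outside ∷ X) = trans (ℤ.+-identityˡ _) (sum-χ X)

mono-⊕ : (T : Subset n) (e : Fin n) (X : Subset n) → mono (T ⊕ e) X ≡ mono T X * χ X e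
mono-⊕ T e X with T ⊆? X
... | yes T⊆X = trans (⟦⟧-cong (T ⊕ e ⊆? X) (e ∈? X) (λ T⊕e⊆X → T⊕e⊆X (∈-⊕-self T e)) (λ e∈X → ⊕-⊆ T e∈X T⊆X))
                      (sym (ℤ.*-identityˡ (χ X e)))
... | no  T⊈X = trans (⟦⟧-no (T ⊕ e ⊆? X) (λ T⊕e⊆X → T⊈X (λ x∈ → T⊕e⊆X (∈-⊕⁺ T e x∈)))) (sym (ℤ.*-zeroˡ (χ X e)))

mono-insert-∉ : (T : Subset n) {a : Fin n} → a ∉ T → (X : Subset n) → mono T (X ⊕ a) ≡ mono T X
mono-insert-∉ T {a} a∉T X = ⟦⟧-cong (T ⊆? X ⊕ a) (T ⊆? X)
  (λ T⊆ {x} x∈T → Sum.[ (λ { refl → contradiction x∈T a∉T }) , (λ x∈X → x∈X) ] (∈-⊕⁻ X a (T⊆ x∈T)))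
  (λ T⊆X x∈T → ∈-⊕⁺ X a (T⊆X x∈T))

-- Only values on sets of size `k` may count. On that slice a monomial of lower degree is a rational
-- combination of monomials of the next degree, which `kills-pred` exploits.
record Functional (n k : ℕ) : Set where
  field
    at      : (Subset n → ℤ) → ℤ
    at-cong : ∀ {f g} → (∀ X → ∣ X ∣ ≡ k → f X ≡ g X) → at f ≡ at g
    at-+    : ∀ f g → at (λ X → f X + g X) ≡ at f + at g
    at-*    : ∀ c f → at (λ X → c * f X) ≡ c * at f

  at-zero : at (λ _ → 0ℤ) ≡ 0ℤ
  at-zero = at-* 0ℤ (λ _ → 0ℤ)

  at-- : ∀ f g → at (λ X → f X - g X) ≡ at f - at g
  at-- f g = trans (at-cong (λ X _ → neg (f X) (g X)))
    (trans (at-+ f (λ X → -1ℤ * g X)) (trans (cong (_+_ (at f)) (at-* -1ℤ g)) (sym (neg (at f) (at g)))))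
    where
    neg : ∀ a b → a - b ≡ a + -1ℤ * b
    neg = solve-∀

  at-sum : ∀ {m} (f : Fin m → Subset n → ℤ) → at (λ X → sum (λ i → f i X)) ≡ sum (λ i → at (f i))
  at-sum {zero}  f = at-zero
  at-sum {suc m} f = trans (at-+ (f zero) (λ X → sum (λ i → f (suc i) X))) (cong (_+_ (at (f zero))) (at-sum (f ∘ suc)))

  at-∑ : {A : Set} (xs : List A) (f : A → Subset n → ℤ) → at (λ X → ∑ xs (λ x → f x X)) ≡ ∑ xs (λ x → at (f x))
  at-∑ []       f = at-zero
  at-∑ (x ∷ xs) f = trans (at-+ (f x) (λ X → ∑ xs (λ x → f x X))) (cong (_+_ (at (f x))) (at-∑ xs f))

  Kills : ℕ → Set
  Kills j = ∀ T → ∣ T ∣ ≡ j → at (mono T) ≡ 0ℤ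

  -- Double counting of T ⊂ T ⊕ y ⊆ X.
  kills-pred : ∀ {j} → j < k → Kills (suc j) → Kills j
  kills-pred {j} j<k kills T ∣T∣≡j with ℤ.i*j≡0⇒i≡0∨j≡0 (+ k - + j) (begin
      (+ k - + j) * at (mono T)                                 ≡⟨ at-* (+ k - + j) (mono T) ⟨
      at (λ X → (+ k - + j) * mono T X)                         ≡⟨ at-cong (λ X ∣X∣≡k → sym (count X ∣X∣≡k)) ⟩
      at (λ X → sum (λ y → ⟦ ¬? (y ∈? T) ⟧ * mono (T ⊕ y) X))   ≡⟨ at-sum (λ y X → ⟦ ¬? (y ∈? T) ⟧ * mono (T ⊕ y) X) ⟩
      sum (λ y → at (λ X → ⟦ ¬? (y ∈? T) ⟧ * mono (T ⊕ y) X))   ≡⟨ sum-zero (λ y → trans (at-* ⟦ ¬? (y ∈? T) ⟧ (mono (T ⊕ y))) (term y)) ⟩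
      0ℤ ∎)
    where
    open ≡-Reasoning
    term : ∀ y → ⟦ ¬? (y ∈? T) ⟧ * at (mono (T ⊕ y)) ≡ 0ℤ
    term y with y ∈? T
    ... | yes _   = ℤ.*-zeroˡ (at (mono (T ⊕ y)))
    ... | no  y∉T = trans (ℤ.*-identityˡ _) (kills (T ⊕ y) (trans (∣⊕∣ T y∉T) (cong suc ∣T∣≡j)))
    pointwise : ∀ X y → ⟦ ¬? (y ∈? T) ⟧ * mono (T ⊕ y) X ≡ mono T X * (χ X y - χ T y)
    pointwise X y with y ∈? T
    ... | no y∉T = trans (ℤ.*-identityˡ _) (trans (mono-⊕ T y X) (cong (mono T X *_) (sym (ℤ.+-identityʳ (χ X y)))))
    ... | yes y∈T with T ⊆? X
    ...   | no  _   = refl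
    ...   | yes T⊆X = sym (trans (ℤ.*-identityˡ _) (cong (_- 1ℤ) (⟦⟧-yes (y ∈? X) (T⊆X y∈T))))
    count : ∀ X → ∣ X ∣ ≡ k → sum (λ y → ⟦ ¬? (y ∈? T) ⟧ * mono (T ⊕ y) X) ≡ (+ k - + j) * mono T X
    count X ∣X∣≡k = begin
      sum (λ y → ⟦ ¬? (y ∈? T) ⟧ * mono (T ⊕ y) X)  ≡⟨ Σ.sum-cong-≗ (pointwise X) ⟩
      sum (λ y → mono T X * (χ X y - χ T y))        ≡⟨ Σ.*-distribˡ-sum (mono T X) (λ y → χ X y - χ T y) ⟨
      mono T X * sum (λ y → χ X y - χ T y)          ≡⟨ ℤ.*-comm (mono T X) _ ⟩
      sum (λ y → χ X y - χ T y) * mono T X          ≡⟨ cong (_* mono T X) (begin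
        sum (λ y → χ X y - χ T y)              ≡⟨ Σ.sum-cong-≗ (λ y → neg (χ X y) (χ T y)) ⟩
        sum (λ y → χ X y + -1ℤ * χ T y)        ≡⟨ Σ.∑-distrib-+ (χ X) (λ y → -1ℤ * χ T y) ⟩
        sum (χ X) + sum (λ y → -1ℤ * χ T y)    ≡⟨ cong (_+_ (sum (χ X))) (Σ.*-distribˡ-sum -1ℤ (χ T)) ⟨
        sum (χ X) + -1ℤ * sum (χ T)            ≡⟨ neg (sum (χ X)) (sum (χ T)) ⟨
        sum (χ X) - sum (χ T)                  ≡⟨ cong₂ _-_ (trans (sum-χ X) (cong +_ ∣X∣≡k)) (trans (sum-χ T) (cong +_ ∣T∣≡j)) ⟩
        + k - + j                              ∎) ⟩
      (+ k - + j) * mono T X                        ∎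
      where
      neg : ∀ a b → a - b ≡ a + -1ℤ * b
      neg = solve-∀
  ... | inj₁ k-j≡0 = contradiction (sym (ℤ.+-injective (ℤ.i-j≡0⇒i≡j _ _ k-j≡0))) (ℕ.<⇒≢ j<k)
  ... | inj₂ eq    = eq

  kills-≤ : ∀ {j} i → i ℕ.+ j ≤ k → Kills (i ℕ.+ j) → Kills j
  kills-≤ zero    _     kills = kills
  kills-≤ (suc i) i+j<k kills = kills-≤ i (ℕ.<⇒≤ i+j<k) (kills-pred i+j<k kills)

-- For `es` disjoint from `T` this is, up to sign, the indicator of the sets whose trace on
-- `T ⊕* es` is `T`. The recursion is its expansion into monomials, to which a functional can be
-- applied.
tracePoly : Subset n → List (Fin n) → Subset n → ℤ
tracePoly T []       X = mono T X
tracePoly T (e ∷ es) X = tracePoly (T ⊕ e) es X - tracePoly T es X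

tracePoly-∏ : (T : Subset n) (es : List (Fin n)) (X : Subset n) →
              tracePoly T es X ≡ mono T X * ∏ es (λ e → χ X e - 1ℤ)
tracePoly-∏ T []       X = sym (ℤ.*-identityʳ (mono T X))
tracePoly-∏ T (e ∷ es) X = trans
  (cong₂ _-_ (trans (tracePoly-∏ (T ⊕ e) es X) (cong (_* π) (mono-⊕ T e X))) (tracePoly-∏ T es X))
  (factor (mono T X) (χ X e) π)
  where
  π = ∏ es (λ e → χ X e - 1ℤ)
  factor : ∀ m x p → m * x * p - m * p ≡ m * ((x - 1ℤ) * p)
  factor = solve-∀

∏-zero : {A : Set} {xs : List A} {f : A → ℤ} {x : A} → x List.∈ xs → f x ≡ 0ℤ → ∏ xs f ≡ 0ℤ
∏-zero {xs = x ∷ xs} {f} (here refl) eq = trans (cong (_* ∏ xs f) eq) (ℤ.*-zeroˡ (∏ xs f))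
∏-zero {xs = x ∷ xs} {f} (there x∈)  eq = trans (cong (f x *_) (∏-zero {xs = xs} {f} x∈ eq)) (ℤ.*-zeroʳ (f x))

tracePoly-insert-∉ : (T : Subset n) (es : List (Fin n)) {a : Fin n} → a ∉ T ⊕* es → (X : Subset n) →
                     tracePoly T es (X ⊕ a) ≡ tracePoly T es X
tracePoly-insert-∉ T []       a∉ X = mono-insert-∉ T a∉ X
tracePoly-insert-∉ T (e ∷ es) {a} a∉ X = cong₂ _-_
  (tracePoly-insert-∉ (T ⊕ e) es a∉ X)
  (tracePoly-insert-∉ T es (λ a∈ → a∉ (subst (a ∈_) (sym (⊕*-comm T e es)) (∈-⊕⁺ (T ⊕* es) e a∈))) X)

module _ {k d : ℕ} (L : Functional n k) (low : ∀ T → ∣ T ∣ < d → Functional.at L (mono T) ≡ 0ℤ) where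

  open Functional L

  private
    drop-head : (T : Subset n) (e : Fin n) (es : List (Fin n)) {m : ℕ} → ∣ T ∣ ℕ.+ length (e ∷ es) ≤ suc m →
                ∣ T ∣ ℕ.+ length es ≤ m
    drop-head T e es le = ℕ.s≤s⁻¹ (ℕ.≤-trans (ℕ.≤-reflexive (sym (ℕ.+-suc ∣ T ∣ (length es)))) le)

    add-head : (T : Subset n) (e : Fin n) (es : List (Fin n)) {m : ℕ} → ∣ T ∣ ℕ.+ length (e ∷ es) ≤ m →
               ∣ T ⊕ e ∣ ℕ.+ length es ≤ m
    add-head T e es le = ℕ.≤-trans (ℕ.+-monoˡ-≤ (length es) (∣⊕∣≤ T e))
      (ℕ.≤-trans (ℕ.≤-reflexive (sym (ℕ.+-suc ∣ T ∣ (length es)))) le)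

  at-tracePoly-< : (T : Subset n) (es : List (Fin n)) → ∣ T ∣ ℕ.+ length es < d → at (tracePoly T es) ≡ 0ℤ
  at-tracePoly-< T []       lt = low T (ℕ.≤-<-trans (ℕ.m≤m+n ∣ T ∣ 0) lt)
  at-tracePoly-< T (e ∷ es) lt = trans (at-- (tracePoly (T ⊕ e) es) (tracePoly T es))
    (cong₂ _-_
      (at-tracePoly-< (T ⊕ e) es (ℕ.≤-trans (s≤s (add-head T e es ℕ.≤-refl)) lt))
      (at-tracePoly-< T es (ℕ.<-trans (ℕ.+-monoʳ-< ∣ T ∣ (ℕ.n<1+n (length es))) lt)))

  at-tracePoly-≤ : (T : Subset n) (es : List (Fin n)) → ∣ T ∣ ℕ.+ length es ≤ d →
                   at (tracePoly T es) ≡ at (mono (T ⊕* es))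
  at-tracePoly-≤ T []       le = refl
  at-tracePoly-≤ T (e ∷ es) le = trans (at-- (tracePoly (T ⊕ e) es) (tracePoly T es))
    (trans (cong₂ _-_ (at-tracePoly-≤ (T ⊕ e) es (add-head T e es le))
                      (at-tracePoly-< T es (ℕ.≤-trans (ℕ.≤-reflexive (sym (ℕ.+-suc ∣ T ∣ (length es)))) le)))
           (ℤ.+-identityʳ _))

  -- Only the two top degrees of the expansion survive, since everything below `d` is killed;
  -- omitting one factor of `es` costs one sign.
  at-tracePoly : (T : Subset n) {es : List (Fin n)} → Unique es → All (_∉ T) es → ∣ T ∣ ℕ.+ length es ≤ suc d →
    at (tracePoly T es) ≡ at (mono (T ⊕* es)) - ∑ es (λ e → at (mono (T ⊕* es ⊖ e)))
  at-tracePoly T [] [] le = sym (ℤ.+-identityʳ _)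
  at-tracePoly T {e ∷ es} (e∉es ∷ u) (e∉T ∷ es∉T) le = begin
    at (tracePoly T (e ∷ es))                       ≡⟨ at-- (tracePoly (T ⊕ e) es) (tracePoly T es) ⟩
    at (tracePoly (T ⊕ e) es) - at (tracePoly T es) ≡⟨ cong₂ _-_
      (at-tracePoly (T ⊕ e) u (All.zipWith (λ (e≢x , x∉T) → ∉-⊕ T (e≢x ∘ sym) x∉T) (e∉es , es∉T)) (add-head T e es le))
      (trans (at-tracePoly-≤ T es (drop-head T e es le)) (cong (at ∘ mono) (sym removed))) ⟩
    (at (mono X) - rest) - at (mono (X ⊖ e))        ≡⟨ regroup (at (mono X)) rest (at (mono (X ⊖ e))) ⟩
    at (mono X) - (at (mono (X ⊖ e)) + rest)        ∎
    where
    open ≡-Reasoning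
    X = (T ⊕ e) ⊕* es
    rest = ∑ es (λ e → at (mono (X ⊖ e)))
    e∉T⊕*es : e ∉ T ⊕* es
    e∉T⊕*es e∈ = Sum.[ e∉T , (λ e∈es → All.lookup e∉es e∈es refl) ] (∈-⊕*⁻ T es e∈)
    removed : X ⊖ e ≡ T ⊕* es
    removed = trans (cong (_⊖ e) (⊕*-comm T e es)) (⊕-⊖ (T ⊕* es) e∉T⊕*es)
    regroup : ∀ a b c → (a - b) - c ≡ a - (c + b)
    regroup = solve-∀

-- Alternating sums over disjoint pairs

Pairs : ℕ → Set
Pairs n = List (Fin n × Fin n)

support : Pairs n → List (Fin n)
support []             = []
support ((p , q) ∷ ps) = p ∷ q ∷ support ps

-- Growing `X` along the list makes the pairs disjoint from each other as well as from `X`.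
Fresh : Subset n → Pairs n → Set
Fresh X []             = ⊤
Fresh X ((p , q) ∷ ps) = p ∉ X × q ∉ X × p ≢ q × Fresh (X ⊕ p ⊕ q) ps

Fresh-⊆ : {X Y : Subset n} (ps : Pairs n) → Y ⊆ X → Fresh X ps → Fresh Y ps
Fresh-⊆ []       Y⊆X _ = tt
Fresh-⊆ {X = X} {Y} ((p , q) ∷ ps) Y⊆X (p∉X , q∉X , p≢q , fresh) =
  (λ p∈Y → p∉X (Y⊆X p∈Y)) , (λ q∈Y → q∉X (Y⊆X q∈Y)) , p≢q ,
  Fresh-⊆ ps (⊕-mono (Y ⊕ p) (⊕-mono Y Y⊆X)) fresh

Fresh-∉ : {X : Subset n} (ps : Pairs n) → Fresh X ps → ∀ {x} → x List.∈ support ps → x ∉ X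
Fresh-∉ ((p , q) ∷ ps) (p∉X , _) (here refl) = p∉X
Fresh-∉ ((p , q) ∷ ps) (_ , q∉X , _) (there (here refl)) = q∉X
Fresh-∉ {X = X} ((p , q) ∷ ps) (_ , _ , _ , fresh) (there (there x∈)) x∈X =
  Fresh-∉ ps fresh x∈ (∈-⊕⁺ (X ⊕ p) q (∈-⊕⁺ X p x∈X))

Misses : Subset n → Fin n × Fin n → Set
Misses T (p , q) = p ∉ T × q ∉ T

-- If every pair is met, one point from each gives distinct elements of `T` because the pairs are
-- disjoint. The points themselves are kept, since `Independence` has to locate them inside the
-- blocks.
misses-or-hits : {X : Subset n} (T : Subset n) (ps : Pairs n) → Fresh X ps →
  Any (Misses T) ps ⊎
  ∃ λ zs → Unique zs × All (_∈ T) zs × All (List._∈ support ps) zs × length zs ≡ length ps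
misses-or-hits T [] fresh = inj₂ ([] , [] , [] , [] , refl)
misses-or-hits {X = X} T ((p , q) ∷ ps) (_ , _ , _ , fresh) with misses-or-hits T ps fresh
... | inj₁ miss = inj₁ (there miss)
... | inj₂ (zs , u , zs∈T , zs∈ps , len) with p ∈? T | q ∈? T
...   | no p∉T | no q∉T = inj₁ (here (p∉T , q∉T))
...   | yes p∈T | _ = inj₂ (p ∷ zs
        , All.map (λ z∈ p≡z → Fresh-∉ ps fresh z∈ (subst (_∈ X ⊕ p ⊕ q) p≡z (∈-⊕⁺ (X ⊕ p) q (∈-⊕-self X p)))) zs∈ps ∷ u
        , p∈T ∷ zs∈T , here refl ∷ All.map (λ z∈ → there (there z∈)) zs∈ps , cong suc len)
...   | no _ | yes q∈T = inj₂ (q ∷ zs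
        , All.map (λ z∈ q≡z → Fresh-∉ ps fresh z∈ (subst (_∈ X ⊕ p ⊕ q) q≡z (∈-⊕-self (X ⊕ p) q))) zs∈ps ∷ u
        , q∈T ∷ zs∈T , there (here refl) ∷ All.map (λ z∈ → there (there z∈)) zs∈ps , cong suc len)

small⇒misses : {X : Subset n} (T : Subset n) (ps : Pairs n) → Fresh X ps → ∣ T ∣ < length ps → Any (Misses T) ps
small⇒misses T ps fresh lt with misses-or-hits T ps fresh
... | inj₁ miss = miss
... | inj₂ (zs , u , zs∈T , _ , len) =
  contradiction (unique-⊆⇒length≤ T u zs∈T) (ℕ.<⇒≱ (subst (∣ T ∣ <_) (sym len) lt))

-- A difference operator of order `length ps`: one point of each pair is added to `X`, with the sign
-- given by the parity of the number of second points.
Δ : Pairs n → (Subset n → ℤ) → Subset n → ℤ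
Δ []             f X = f X
Δ ((p , q) ∷ ps) f X = Δ ps f (X ⊕ p) - Δ ps f (X ⊕ q)

Δ-functional : (X : Subset n) (ps : Pairs n) → Fresh X ps → {k : ℕ} → ∣ X ∣ ℕ.+ length ps ≡ k → Functional n k
Δ-functional {n} X ps fresh {k} size = record
  { at      = λ f → Δ ps f X
  ; at-cong = λ {f} {g} f≗g → Δ-cong f≗g X ps fresh size
  ; at-+    = λ f g → Δ-+ f g X ps
  ; at-*    = λ c f → Δ-* c f X ps
  }
  where
  Δ-cong : ∀ {f g} → (∀ X → ∣ X ∣ ≡ k → f X ≡ g X) →
           ∀ X ps → Fresh X ps → ∣ X ∣ ℕ.+ length ps ≡ k → Δ ps f X ≡ Δ ps g X
  Δ-cong f≗g X [] _ size = f≗g X (trans (sym (ℕ.+-identityʳ _)) size)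
  Δ-cong f≗g X ((p , q) ∷ ps) (p∉X , q∉X , _ , fresh) size = cong₂ _-_
    (Δ-cong f≗g (X ⊕ p) ps (Fresh-⊆ ps (λ x∈ → ∈-⊕⁺ (X ⊕ p) q x∈) fresh) (grow p∉X))
    (Δ-cong f≗g (X ⊕ q) ps (Fresh-⊆ ps (⊕-mono X (∈-⊕⁺ X p)) fresh) (grow q∉X))
    where
    grow : ∀ {e} → e ∉ X → ∣ X ⊕ e ∣ ℕ.+ length ps ≡ k
    grow e∉X = trans (cong (ℕ._+ length ps) (∣⊕∣ X e∉X)) (trans (sym (ℕ.+-suc ∣ X ∣ (length ps))) size)
  Δ-+ : ∀ f g X ps → Δ ps (λ Y → f Y + g Y) X ≡ Δ ps f X + Δ ps g X
  Δ-+ f g X [] = refl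
  Δ-+ f g X ((p , q) ∷ ps) = trans (cong₂ _-_ (Δ-+ f g (X ⊕ p) ps) (Δ-+ f g (X ⊕ q) ps))
    (regroup (Δ ps f (X ⊕ p)) (Δ ps g (X ⊕ p)) (Δ ps f (X ⊕ q)) (Δ ps g (X ⊕ q)))
    where
    regroup : ∀ a b c d → (a + b) - (c + d) ≡ (a - c) + (b - d)
    regroup = solve-∀
  Δ-* : ∀ c f X ps → Δ ps (λ Y → c * f Y) X ≡ c * Δ ps f X
  Δ-* c f X [] = refl
  Δ-* c f X ((p , q) ∷ ps) = trans (cong₂ _-_ (Δ-* c f (X ⊕ p) ps) (Δ-* c f (X ⊕ q) ps))
    (factor c (Δ ps f (X ⊕ p)) (Δ ps f (X ⊕ q)))
    where
    factor : ∀ c a b → c * a - c * b ≡ c * (a - b)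
    factor = solve-∀

Δ-insert : {f : Subset n → ℤ} {a : Fin n} → (∀ X → f (X ⊕ a) ≡ f X) →
           ∀ ps X → Δ ps f (X ⊕ a) ≡ Δ ps f X
Δ-insert ign [] X = ign X
Δ-insert {f = f} {a} ign ((p , q) ∷ ps) X = cong₂ _-_ (step p) (step q)
  where
  step : ∀ e → Δ ps f (X ⊕ a ⊕ e) ≡ Δ ps f (X ⊕ e)
  step e = trans (cong (Δ ps f) (⊕-comm X a e)) (Δ-insert ign ps (X ⊕ e))

-- A function that sees only `T` takes equal values on the two choices from a missed pair, and these
-- carry opposite signs.
Δ-misses : {f : Subset n → ℤ} {T : Subset n} → (∀ {a} → a ∉ T → ∀ X → f (X ⊕ a) ≡ f X) →
           ∀ ps → Any (Misses T) ps → ∀ X → Δ ps f X ≡ 0ℤ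
Δ-misses ign ((p , q) ∷ ps) (here (p∉T , q∉T)) X =
  ℤ.i≡j⇒i-j≡0 (trans (Δ-insert (ign p∉T) ps X) (sym (Δ-insert (ign q∉T) ps X)))
Δ-misses ign ((p , q) ∷ ps) (there miss) X =
  cong₂ _-_ (Δ-misses ign ps miss (X ⊕ p)) (Δ-misses ign ps miss (X ⊕ q))

balance : Subset n → Fin n × Fin n → ℤ
balance T (p , q) = χ T p - χ T q

-- The signed sum factors over the pairs. A pair inside `T` gives 0, since no choice takes both
-- points, and a pair disjoint from `T` gives 0 by cancellation. The last factor only asks that `T`
-- lie within `X` and the pairs.
Δ-mono : (T X : Subset n) (ps : Pairs n) → Fresh X ps →
         Δ ps (mono T) X ≡ ∏ ps (balance T) * mono T (X ⊕* support ps)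
Δ-mono T X [] _ = sym (ℤ.*-identityˡ (mono T X))
Δ-mono T X ((p , q) ∷ ps) (p∉X , q∉X , p≢q , fresh) = begin
  Δ ps (mono T) (X ⊕ p) - Δ ps (mono T) (X ⊕ q)
    ≡⟨ cong₂ _-_ (Δ-mono T (X ⊕ p) ps (Fresh-⊆ ps (λ x∈ → ∈-⊕⁺ (X ⊕ p) q x∈) fresh))
                 (Δ-mono T (X ⊕ q) ps (Fresh-⊆ ps (⊕-mono X (∈-⊕⁺ X p)) fresh)) ⟩
  π * mono T ((X ⊕ p) ⊕* support ps) - π * mono T ((X ⊕ q) ⊕* support ps)
    ≡⟨ cong₂ (λ S S′ → π * mono T S - π * mono T S′) (⊕*-comm X p (support ps)) (⊕*-comm X q (support ps)) ⟩
  π * mono T (Y ⊕ p) - π * mono T (Y ⊕ q)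
    ≡⟨ factor π (mono T (Y ⊕ p)) (mono T (Y ⊕ q)) ⟩
  π * (mono T (Y ⊕ p) - mono T (Y ⊕ q))
    ≡⟨ cong (π *_) two-points ⟩
  π * (balance T (p , q) * mono T (Y ⊕ p ⊕ q))
    ≡⟨ reorder π (balance T (p , q)) (mono T (Y ⊕ p ⊕ q)) ⟩
  balance T (p , q) * π * mono T (Y ⊕ p ⊕ q)
    ≡⟨ cong (λ S → balance T (p , q) * π * mono T S)
         (trans (⊕*-comm (X ⊕ p) q (support ps)) (cong (_⊕ q) (⊕*-comm X p (support ps)))) ⟨
  balance T (p , q) * π * mono T ((X ⊕ p ⊕ q) ⊕* support ps) ∎
  where
  open ≡-Reasoning
  π = ∏ ps (balance T)
  Y = X ⊕* support ps
  factor : ∀ a b c → a * b - a * c ≡ a * (b - c)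
  factor = solve-∀
  reorder : ∀ a b c → a * (b * c) ≡ b * a * c
  reorder = solve-∀
  p∉Y : p ∉ Y
  p∉Y p∈ = Sum.[ p∉X , (λ p∈ps → Fresh-∉ ps fresh p∈ps (∈-⊕⁺ (X ⊕ p) q (∈-⊕-self X p))) ] (∈-⊕*⁻ X (support ps) p∈)
  q∉Y : q ∉ Y
  q∉Y q∈ = Sum.[ q∉X , (λ q∈ps → Fresh-∉ ps fresh q∈ps (∈-⊕-self (X ⊕ p) q)) ] (∈-⊕*⁻ X (support ps) q∈)
  absent : ∀ {e S} → e ∈ T → e ∉ S → mono T S ≡ 0ℤ
  absent {S = S} e∈T e∉S = ⟦⟧-no (T ⊆? S) (λ T⊆S → e∉S (T⊆S e∈T))
  two-points : mono T (Y ⊕ p) - mono T (Y ⊕ q) ≡ balance T (p , q) * mono T (Y ⊕ p ⊕ q)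
  two-points with p ∈? T | q ∈? T
  ... | yes p∈T | yes q∈T = cong₂ _-_ (absent q∈T (∉-⊕ Y (p≢q ∘ sym) q∉Y)) (absent p∈T (∉-⊕ Y p≢q p∉Y))
  ... | yes p∈T | no  q∉T = trans
        (cong₂ _-_ (sym (mono-insert-∉ T q∉T (Y ⊕ p))) (absent p∈T (∉-⊕ Y p≢q p∉Y)))
        (identity (mono T (Y ⊕ p ⊕ q)))
        where
        identity : ∀ a → a - 0ℤ ≡ (1ℤ - 0ℤ) * a
        identity = solve-∀
  ... | no  p∉T | yes q∈T = trans
        (cong₂ _-_ (absent q∈T (∉-⊕ Y (p≢q ∘ sym) q∉Y))
                   (trans (sym (mono-insert-∉ T p∉T (Y ⊕ q))) (cong (mono T) (⊕-comm Y q p))))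
        (identity (mono T (Y ⊕ p ⊕ q)))
        where
        identity : ∀ a → 0ℤ - a ≡ (0ℤ - 1ℤ) * a
        identity = solve-∀
  ... | no  p∉T | no  q∉T = ℤ.i≡j⇒i-j≡0 (trans (mono-insert-∉ T p∉T Y) (sym (mono-insert-∉ T q∉T Y)))

∣⟦⟧∣≤1 : {P : Set} (P? : Dec P) → ℤ.∣ ⟦ P? ⟧ ∣ ≤ 1
∣⟦⟧∣≤1 (yes _) = s≤s z≤n
∣⟦⟧∣≤1 (no  _) = z≤n

⟦⟧-nonneg : {P : Set} (P? : Dec P) → 0ℤ ℤ.≤ ⟦ P? ⟧
⟦⟧-nonneg (yes _) = ℤ.+≤+ z≤n
⟦⟧-nonneg (no  _) = ℤ.+≤+ z≤n

∣*∣≤1 : ∀ a b → ℤ.∣ a ∣ ≤ 1 → ℤ.∣ b ∣ ≤ 1 → ℤ.∣ a * b ∣ ≤ 1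
∣*∣≤1 a b ∣a∣≤1 ∣b∣≤1 = ℕ.≤-trans (ℕ.≤-reflexive (ℤ.abs-* a b)) (ℕ.*-mono-≤ ∣a∣≤1 ∣b∣≤1)

∣∏∣≤1 : {A : Set} (xs : List A) {f : A → ℤ} → (∀ x → ℤ.∣ f x ∣ ≤ 1) → ℤ.∣ ∏ xs f ∣ ≤ 1
∣∏∣≤1 []           f≤1 = s≤s z≤n
∣∏∣≤1 (x ∷ xs) {f} f≤1 = ∣*∣≤1 (f x) (∏ xs f) (f≤1 x) (∣∏∣≤1 xs {f} f≤1)

∣balance∣≤1 : (T : Subset n) (pq : Fin n × Fin n) → ℤ.∣ balance T pq ∣ ≤ 1
∣balance∣≤1 T (p , q) with p ∈? T | q ∈? T
... | yes _ | yes _ = z≤n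
... | yes _ | no  _ = s≤s z≤n
... | no  _ | yes _ = s≤s z≤n
... | no  _ | no  _ = z≤n

-- Families with missing traces

record MissingTraces (n d : ℕ) : Set where
  field
    F       : List (Subset n)
    F!      : Unique F
    size    : ∀ {X} → X List.∈ F → ∣ X ∣ ≡ suc d
    B       : Subset n → Subset n
    B⊆      : ∀ {X} → X List.∈ F → B X ⊆ X
    missing : ∀ {X Y} → X List.∈ F → Y List.∈ F → Y ∩ X ≢ B X

module Polynomials {n d} (M : MissingTraces n d) where
  open MissingTraces M

  rest : Subset n → List (Fin n)
  rest X = select (λ e → (e ∈? X) ×-dec ¬? (e ∈? B X))

  rest! : ∀ X → Unique (rest X)
  rest! X = select-unique (λ e → (e ∈? X) ×-dec ¬? (e ∈? B X))

  ∈-rest⁺ : ∀ X {e} → e ∈ X → e ∉ B X → e List.∈ rest X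
  ∈-rest⁺ X e∈X e∉B = ∈-select⁺ (λ e → (e ∈? X) ×-dec ¬? (e ∈? B X)) (e∈X , e∉B)

  ∈-rest⁻ : ∀ X {e} → e List.∈ rest X → e ∈ X × e ∉ B X
  ∈-rest⁻ X = ∈-select⁻ (λ e → (e ∈? X) ×-dec ¬? (e ∈? B X))

  rest-∉ : ∀ X → All (_∉ B X) (rest X)
  rest-∉ X = All.tabulate (λ e∈ → proj₂ (∈-rest⁻ X e∈))

  B⊕*rest : ∀ {X} → X List.∈ F → B X ⊕* rest X ≡ X
  B⊕*rest {X} X∈F = ⊆-antisym
    (λ e∈ → Sum.[ B⊆ X∈F , (λ e∈rest → proj₁ (∈-rest⁻ X e∈rest)) ] (∈-⊕*⁻ (B X) (rest X) e∈))
    cover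
    where
    cover : X ⊆ B X ⊕* rest X
    cover {e} e∈X with e ∈? B X
    ... | yes e∈B = ⊆-⊕* (B X) (rest X) e∈B
    ... | no  e∉B = ∈-⊕*⁺ (B X) (∈-rest⁺ X e∈X e∉B)

  ∣B∣+∣rest∣ : ∀ {X} → X List.∈ F → ∣ B X ∣ ℕ.+ length (rest X) ≡ suc d
  ∣B∣+∣rest∣ {X} X∈F = trans (sym (∣⊕*∣ (B X) (rest! X) (rest-∉ X))) (trans (cong ∣_∣ (B⊕*rest X∈F)) (size X∈F))

  -- Of degree at most d on the slice, since the monomial of X cancels.
  dual : Subset n → Subset n → ℤ
  dual X Y = mono X Y - tracePoly (B X) (rest X) Y

  -- A member `Y` containing `B X` also contains a vertex of `X` outside `B X`, as its trace on `X`
  -- would otherwise be `B X`; the factor of that vertex is 0.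
  tracePoly-F : ∀ {X Y} → X List.∈ F → Y List.∈ F → tracePoly (B X) (rest X) Y ≡ 0ℤ
  tracePoly-F {X} {Y} X∈F Y∈F = trans (tracePoly-∏ (B X) (rest X) Y) vanish
    where
    π = ∏ (rest X) (λ e → χ Y e - 1ℤ)
    vanish : mono (B X) Y * π ≡ 0ℤ
    vanish with B X ⊆? Y
    ... | no  _   = ℤ.*-zeroˡ π
    ... | yes B⊆Y with Fin.any? (λ e → ((e ∈? X) ×-dec ¬? (e ∈? B X)) ×-dec (e ∈? Y))
    ...   | yes (e , (e∈X , e∉B) , e∈Y) = trans (ℤ.*-identityˡ π)
            (∏-zero {f = λ e → χ Y e - 1ℤ} (∈-rest⁺ X e∈X e∉B) (cong (_- 1ℤ) (⟦⟧-yes (e ∈? Y) e∈Y)))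
    ...   | no none = contradiction
            (⊆-antisym
              (λ {e} e∈ → decidable-stable (e ∈? B X) (λ e∉B →
                none (e , (p∩q⊆q Y X e∈ , e∉B) , p∩q⊆p Y X e∈)))
              (λ e∈B → x∈p∩q⁺ (B⊆Y e∈B , B⊆ X∈F e∈B)))
            (missing X∈F Y∈F)

  dual-F : ∀ {X Y} → X List.∈ F → Y List.∈ F → dual X Y ≡ mono X Y
  dual-F {X} {Y} X∈F Y∈F = trans (cong (λ t → mono X Y - t) (tracePoly-F X∈F Y∈F)) (ℤ.+-identityʳ _)

  dual-self : ∀ {X} → X List.∈ F → dual X X ≡ 1ℤ
  dual-self {X} X∈F = trans (dual-F X∈F X∈F) (⟦⟧-yes (X ⊆? X) (λ x∈ → x∈))

  dual-other : ∀ {X Y} → X List.∈ F → Y List.∈ F → X ≢ Y → dual X Y ≡ 0ℤ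
  dual-other {X} {Y} X∈F Y∈F X≢Y = trans (dual-F X∈F Y∈F) (⟦⟧-no (X ⊆? Y)
    (λ X⊆Y → X≢Y (⊆-∣∣-≡ X⊆Y (ℕ.≤-reflexive (trans (size Y∈F) (sym (size X∈F)))))))

  -- `dual X` depends only on the trace on `X`. This locality underlies the orthogonality of distant
  -- gadgets.
  dual-insert-∉ : ∀ {X a} → X List.∈ F → a ∉ X → ∀ Y → dual X (Y ⊕ a) ≡ dual X Y
  dual-insert-∉ {X} {a} X∈F a∉X Y = cong₂ _-_ (mono-insert-∉ X a∉X Y)
    (tracePoly-insert-∉ (B X) (rest X) (λ a∈ → a∉X (subst (a ∈_) (B⊕*rest X∈F) a∈)) Y)

  -- The monomial of `D` minus its interpolation on `F`, with the duals as Lagrange basis.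
  vanishing : Subset n → Subset n → ℤ
  vanishing D Y = mono D Y - ∑ F (λ X → mono D X * dual X Y)

  vanishing-F : ∀ D {Y} → Y List.∈ F → vanishing D Y ≡ 0ℤ
  vanishing-F D {Y} Y∈F = ℤ.i≡j⇒i-j≡0 (sym (begin
    ∑ F (λ X → mono D X * dual X Y)  ≡⟨ ∑-single F! Y∈F (λ {X} X∈F X≢Y →
      trans (cong (mono D X *_) (dual-other X∈F Y∈F X≢Y)) (ℤ.*-zeroʳ (mono D X))) ⟩
    mono D Y * dual Y Y              ≡⟨ cong (mono D Y *_) (dual-self Y∈F) ⟩
    mono D Y * 1ℤ                    ≡⟨ ℤ.*-identityʳ (mono D Y) ⟩
    mono D Y                         ∎))
    where open ≡-Reasoning

  Active : Subset n → Subset n × Fin n → Set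
  Active D (X , e) = D ⊆ X × e ∈ X × e ∉ B X

  active? : ∀ D Xe → Dec (Active D Xe)
  active? D (X , e) = (D ⊆? X) ×-dec ((e ∈? X) ×-dec ¬? (e ∈? B X))

  incidences : List (Subset n × Fin n)
  incidences = cartesianProduct F (allFin n)

  module _ {k} (L : Functional n k) where

    open Functional L

    -- The only monomial of degree d + 1 cancels and degrees below `d` are killed, so just the
    -- facets opposite the vertices outside `B X` remain.
    at-dual : (∀ T → ∣ T ∣ < d → at (mono T) ≡ 0ℤ) → ∀ {X} → X List.∈ F →
              at (dual X) ≡ ∑ (rest X) (λ e → at (mono (X ⊖ e)))
    at-dual low {X} X∈F = begin
      at (dual X)
        ≡⟨ at-- (mono X) (tracePoly (B X) (rest X)) ⟩
      at (mono X) - at (tracePoly (B X) (rest X))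
        ≡⟨ cong (λ t → at (mono X) - t) (at-tracePoly L low (B X) (rest! X) (rest-∉ X) (ℕ.≤-reflexive (∣B∣+∣rest∣ X∈F))) ⟩
      at (mono X) - (at (mono (B X ⊕* rest X)) - ∑ (rest X) (λ e → at (mono (B X ⊕* rest X ⊖ e))))
        ≡⟨ cong (λ S → at (mono X) - (at (mono S) - ∑ (rest X) (λ e → at (mono (S ⊖ e))))) (B⊕*rest X∈F) ⟩
      at (mono X) - (at (mono X) - ∑ (rest X) (λ e → at (mono (X ⊖ e))))
        ≡⟨ cancel (at (mono X)) (∑ (rest X) (λ e → at (mono (X ⊖ e)))) ⟩
      ∑ (rest X) (λ e → at (mono (X ⊖ e))) ∎
      where
      open ≡-Reasoning
      cancel : ∀ a s → a - (a - s) ≡ s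
      cancel = solve-∀

    at-vanishing : ∀ D → at (vanishing D) ≡ at (mono D) - ∑ F (λ X → mono D X * at (dual X))
    at-vanishing D = trans (at-- (mono D) (λ Y → ∑ F (λ X → mono D X * dual X Y)))
      (cong (λ t → at (mono D) - t) (trans (at-∑ F (λ X Y → mono D X * dual X Y))
        (∑-cong F (λ {X} _ → at-* (mono D X) (dual X)))))

    -- Indexing by pairs (X, e) makes each term a single monomial value; when `at` is an alternating
    -- sum these values are 1, 0 or -1 and can be counted.
    at-vanishing-incidences : (∀ T → ∣ T ∣ < d → at (mono T) ≡ 0ℤ) → ∀ D →
      at (vanishing D) ≡ at (mono D) - ∑ incidences (λ (X , e) → ⟦ active? D (X , e) ⟧ * at (mono (X ⊖ e)))
    at-vanishing-incidences low D = trans (at-vanishing D) (cong (λ t → at (mono D) - t) (trans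
      (∑-cong F member)
      (sym (∑-cartesianProduct F (allFin n) (λ (X , e) → ⟦ active? D (X , e) ⟧ * at (mono (X ⊖ e)))))))
      where
      member : ∀ {X} → X List.∈ F →
        mono D X * at (dual X) ≡ ∑ (allFin n) (λ e → ⟦ active? D (X , e) ⟧ * at (mono (X ⊖ e)))
      member {X} X∈F = begin
        mono D X * at (dual X)
          ≡⟨ cong (mono D X *_) (trans (at-dual low X∈F)
               (∑-filter (λ e → (e ∈? X) ×-dec ¬? (e ∈? B X)) (allFin n) (λ e → at (mono (X ⊖ e))))) ⟩
        mono D X * ∑ (allFin n) (λ e → ⟦ (e ∈? X) ×-dec ¬? (e ∈? B X) ⟧ * at (mono (X ⊖ e)))
          ≡⟨ ∑-*ˡ (allFin n) (mono D X) _ ⟩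
        ∑ (allFin n) (λ e → mono D X * (⟦ (e ∈? X) ×-dec ¬? (e ∈? B X) ⟧ * at (mono (X ⊖ e))))
          ≡⟨ ∑-cong (allFin n) (λ {e} _ → absorb e) ⟩
        ∑ (allFin n) (λ e → ⟦ active? D (X , e) ⟧ * at (mono (X ⊖ e))) ∎
        where
        open ≡-Reasoning
        absorb : ∀ e → mono D X * (⟦ (e ∈? X) ×-dec ¬? (e ∈? B X) ⟧ * at (mono (X ⊖ e))) ≡
                        ⟦ active? D (X , e) ⟧ * at (mono (X ⊖ e))
        absorb e with D ⊆? X
        ... | yes _ = ℤ.*-identityˡ _
        ... | no  _ = trans (ℤ.*-zeroˡ (⟦ (e ∈? X) ×-dec ¬? (e ∈? B X) ⟧ * at (mono (X ⊖ e))))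
                            (sym (ℤ.*-zeroˡ (at (mono (X ⊖ e)))))

-- Disjoint partners and the signs of balances

matching : (K U X : Subset n) {es : List (Fin n)} → Unique es → All (_∉ X) es → All (_∈ U) es → X ⊆ U →
  ∣ U ∣ ℕ.+ length es ≤ ∣ K ∣ →
  ∃ λ ps → map proj₁ ps ≡ es × Fresh X ps × All (λ (_ , q) → q ∈ K × q ∉ U) ps
matching K U X {[]} _ _ _ _ _ = [] , refl , tt , []
matching K U X {e ∷ es} (e∉es ∷ u) (e∉X ∷ es∉X) (e∈U ∷ es∈U) X⊆U room
  -- `U` holds every vertex already used and every element still to be matched, so any vertex of `K`
  -- outside `U` is a legal partner.
  with ∃∉ K U (ℕ.<-≤-trans (ℕ.m<m+n ∣ U ∣ (s≤s z≤n)) room)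
... | q , q∈K , q∉U with matching K (U ⊕ q) (X ⊕ e ⊕ q) u
        (All.tabulate (λ {x} x∈ → ∉-⊕ (X ⊕ e) (λ { refl → q∉U (All.lookup es∈U x∈) })
                                  (∉-⊕ X (λ { refl → All.lookup e∉es x∈ refl }) (All.lookup es∉X x∈))))
        (All.map (∈-⊕⁺ U q) es∈U)
        (⊕-mono (X ⊕ e) (⊕-⊆ X e∈U X⊆U))
        (ℕ.≤-trans (ℕ.+-monoˡ-≤ (length es) (∣⊕∣≤ U q)) (ℕ.≤-trans (ℕ.≤-reflexive (sym (ℕ.+-suc ∣ U ∣ (length es)))) room))
...   | ps , firsts , fresh , seconds = (e , q) ∷ ps , cong (e ∷_) firsts
        , (e∉X , (λ q∈X → q∉U (X⊆U q∈X)) , (λ { refl → q∉U e∈U }) , fresh)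
        , (q∈K , q∉U) ∷ All.map (λ (q′∈K , q′∉) → q′∈K , proj₂ (∉-⊕⁻ U q′∉)) seconds

pick : (K U : Subset n) (m : ℕ) → ∣ U ∣ ℕ.+ m ≤ ∣ K ∣ →
  ∃ λ zs → Unique zs × All (_∈ K) zs × All (_∉ U) zs × length zs ≡ m
pick K U zero    room = [] , [] , [] , [] , refl
pick K U (suc m) room with ∃∉ K U (ℕ.<-≤-trans (ℕ.m<m+n ∣ U ∣ (s≤s z≤n)) room)
... | z , z∈K , z∉U with pick K (U ⊕ z) m
        (ℕ.≤-trans (ℕ.+-monoˡ-≤ m (∣⊕∣≤ U z)) (ℕ.≤-trans (ℕ.≤-reflexive (sym (ℕ.+-suc ∣ U ∣ m))) room))
...   | zs , u , zs∈K , zs∉ , len = z ∷ zs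
        , All.map (λ {x} x∉ z≡x → proj₁ (∉-⊕⁻ U x∉) (sym z≡x)) zs∉ ∷ u
        , z∈K ∷ zs∈K , z∉U ∷ All.map (λ x∉ → proj₂ (∉-⊕⁻ U x∉)) zs∉ , cong suc len

support-∈ : {P : Fin n → Set} {ps : Pairs n} → All (λ (p , q) → P p × P q) ps → All P (support ps)
support-∈ [] = []
support-∈ ((Pp , Pq) ∷ Pps) = Pp ∷ Pq ∷ support-∈ Pps

firsts⊆support : (ps : Pairs n) {x : Fin n} → x List.∈ map proj₁ ps → x List.∈ support ps
firsts⊆support (_ ∷ ps) (here x≡)  = here x≡
firsts⊆support (_ ∷ ps) (there x∈) = there (there (firsts⊆support ps x∈))

balance-in-out : (T : Subset n) {p q : Fin n} → p ∈ T → q ∉ T → balance T (p , q) ≡ 1ℤ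
balance-in-out T p∈T q∉T = cong₂ _-_ (⟦⟧-yes (_ ∈? T) p∈T) (⟦⟧-no (_ ∈? T) q∉T)

balance-out-in : (T : Subset n) {p q : Fin n} → p ∉ T → q ∈ T → balance T (p , q) ≡ -1ℤ
balance-out-in T p∉T q∈T = cong₂ _-_ (⟦⟧-no (_ ∈? T) p∉T) (⟦⟧-yes (_ ∈? T) q∈T)

balance-out-out : (T : Subset n) {p q : Fin n} → p ∉ T → q ∉ T → balance T (p , q) ≡ 0ℤ
balance-out-out T p∉T q∉T = cong₂ _-_ (⟦⟧-no (_ ∈? T) p∉T) (⟦⟧-no (_ ∈? T) q∉T)

balance-in : (T : Subset n) {p : Fin n} (q : Fin n) → p ∈ T → 0ℤ ℤ.≤ balance T (p , q)
balance-in T q p∈T with q ∈? T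
... | yes q∈T rewrite ⟦⟧-yes (_ ∈? T) p∈T = ℤ.≤-refl
... | no  q∉T rewrite ⟦⟧-yes (_ ∈? T) p∈T = ℤ.+≤+ z≤n

balance-out : (T : Subset n) {p : Fin n} (q : Fin n) → p ∉ T → balance T (p , q) ℤ.≤ 0ℤ
balance-out T q p∉T with q ∈? T
... | yes q∈T rewrite ⟦⟧-no (_ ∈? T) p∉T = ℤ.-≤+
... | no  q∉T rewrite ⟦⟧-no (_ ∈? T) p∉T = ℤ.≤-refl

∏-one : {A : Set} (f : A → ℤ) {xs : List A} → All (λ x → f x ≡ 1ℤ) xs → ∏ xs f ≡ 1ℤ
∏-one f []           = refl
∏-one f (fx≡1 ∷ f≡1) = cong₂ _*_ fx≡1 (∏-one f f≡1)

*-nonneg : ∀ {a b} → 0ℤ ℤ.≤ a → 0ℤ ℤ.≤ b → 0ℤ ℤ.≤ a * b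
*-nonneg {a} {b} 0≤a 0≤b = subst (ℤ._≤ a * b) (ℤ.*-zeroʳ a) (ℤ.*-monoˡ-≤-nonNeg a ⦃ ℤ.nonNegative 0≤a ⦄ 0≤b)

*-nonpos-nonneg : ∀ {a b} → a ℤ.≤ 0ℤ → 0ℤ ℤ.≤ b → a * b ℤ.≤ 0ℤ
*-nonpos-nonneg {a} {b} a≤0 0≤b = subst (a * b ℤ.≤_) (ℤ.*-zeroˡ b) (ℤ.*-monoʳ-≤-nonNeg b ⦃ ℤ.nonNegative 0≤b ⦄ a≤0)

*-nonneg-nonpos : ∀ {a b} → 0ℤ ℤ.≤ a → b ℤ.≤ 0ℤ → a * b ℤ.≤ 0ℤ
*-nonneg-nonpos {a} {b} 0≤a b≤0 = subst (ℤ._≤ 0ℤ) (ℤ.*-comm b a) (*-nonpos-nonneg b≤0 0≤a)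

∏-nonneg : {A : Set} {xs : List A} {f : A → ℤ} → All (λ x → 0ℤ ℤ.≤ f x) xs → 0ℤ ℤ.≤ ∏ xs f
∏-nonneg []           = ℤ.+≤+ z≤n
∏-nonneg (0≤fx ∷ 0≤f) = *-nonneg 0≤fx (∏-nonneg 0≤f)

-- The pair of `e` has a factor at most 0 because its first point is absent; all other first points
-- are present, which makes their factors nonnegative.
∏-balance-nonpos : (T : Subset n) {e : Fin n} (ps : Pairs n) → Unique (map proj₁ ps) →
  e ∉ T → All (λ (p , _) → p ≢ e → p ∈ T) ps → e List.∈ map proj₁ ps → ∏ ps (balance T) ℤ.≤ 0ℤ
∏-balance-nonpos T ((p , q) ∷ ps) (p∉ps ∷ _) e∉T (_ ∷ ps∈T) (here refl) = *-nonpos-nonneg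
  (balance-out T q e∉T)
  (∏-nonneg (All.tabulate (λ {pq} pq∈ → balance-in T (proj₂ pq)
    (All.lookup ps∈T pq∈ (λ p′≡p → All.lookup p∉ps (∈-map⁺ proj₁ pq∈) (sym p′≡p))))))
∏-balance-nonpos T ((p , q) ∷ ps) (p∉ps ∷ u) e∉T (p∈T ∷ ps∈T) (there e∈) = *-nonneg-nonpos
  (balance-in T q (p∈T (λ { refl → All.lookup p∉ps e∈ refl })))
  (∏-balance-nonpos T ps u e∉T ps∈T e∈)

-- Gadgets and their incidence sums

module Local {n d} (M : MissingTraces n d) where
  open MissingTraces M
  open Polynomials M

  -- `D` may leave `K` at `u`, and the pairs may leave it at `u` and `v`. The base point `c` raises
  -- the sets evaluated from size d to size d + 1.
  record Gadget (K : Subset n) : Set where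
    field
      D        : Subset n
      ps       : Pairs n
      c u v    : Fin n
      D⊆       : D ⊆ K ⊕ u
      ∣D∣      : ∣ D ∣ ≡ d
      ps⊆      : All (_∈ K ⊕ u ⊕ v) (support ps)
      length-ps : length ps ≡ d
      fresh    : Fresh ⁅ c ⁆ ps
      nonzero  : Δ ps (vanishing D) ⁅ c ⁆ ≢ 0ℤ

  gadget-functional : {c : Fin n} {ps : Pairs n} → Fresh ⁅ c ⁆ ps → length ps ≡ d → Functional n (suc d)
  gadget-functional {c} {ps} fresh len =
    Δ-functional ⁅ c ⁆ ps fresh (cong₂ ℕ._+_ (∣⁅x⁆∣≡1 c) len)

  Δ-low : {c : Fin n} {ps : Pairs n} → Fresh ⁅ c ⁆ ps → length ps ≡ d → ∀ T → ∣ T ∣ < d → Δ ps (mono T) ⁅ c ⁆ ≡ 0ℤ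
  Δ-low {c} {ps} fresh len T lt = Δ-misses (λ a∉T → mono-insert-∉ T a∉T) ps
    (small⇒misses T ps fresh (subst (∣ T ∣ <_) (sym len) lt)) ⁅ c ⁆

  -- The condition on `B` makes `(D ⊕ e , e)` an active incidence, whose facet is `D` itself.
  Extends : Subset n → Fin n → Set
  Extends D e = e ∉ D × D ⊕ e List.∈ F × e ∉ B (D ⊕ e)

  TwoExtensions : Subset n → Set
  TwoExtensions D = ∃₂ λ e f → e ≢ f × Extends D e × Extends D f

  superset : ∀ {D X z} → ∣ D ∣ ≡ d → X List.∈ F → D ⊆ X → z ∈ X → z ∉ D → D ⊕ z ≡ X
  superset {D} ∣D∣ X∈F D⊆X z∈X z∉D = ⊆-∣∣-≡ (⊕-⊆ D z∈X D⊆X)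
    (ℕ.≤-reflexive (trans (size X∈F) (sym (trans (∣⊕∣ D z∉D) (cong suc ∣D∣)))))

  module _ (D : Subset n) (c : Fin n) (ps : Pairs n) where

    opaque
      contribution : Subset n × Fin n → ℤ
      contribution (X , e) = ⟦ active? D (X , e) ⟧ * Δ ps (mono (X ⊖ e)) ⁅ c ⁆

      contribution-active : ∀ {X e} → Active D (X , e) → contribution (X , e) ≡ Δ ps (mono (X ⊖ e)) ⁅ c ⁆
      contribution-active {X} {e} act = trans (cong (_* Δ ps (mono (X ⊖ e)) ⁅ c ⁆) (⟦⟧-yes (active? D (X , e)) act)) (ℤ.*-identityˡ _)

    module _ (fresh : Fresh ⁅ c ⁆ ps) where

      opaque
        unfolding contribution

        contribution≤1 : ∀ Xe → contribution Xe ℤ.≤ 1ℤ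
        contribution≤1 (X , e) = ℤ.≤-trans (i≤∣i∣ (contribution (X , e))) (ℤ.+≤+ (∣*∣≤1 ⟦ active? D (X , e) ⟧ _
          (∣⟦⟧∣≤1 (active? D (X , e)))
          (subst (λ t → ℤ.∣ t ∣ ≤ 1) (sym (Δ-mono (X ⊖ e) ⁅ c ⁆ ps fresh))
            (∣*∣≤1 (∏ ps (balance (X ⊖ e))) _ (∣∏∣≤1 ps {balance (X ⊖ e)} (∣balance∣≤1 (X ⊖ e))) (∣⟦⟧∣≤1 (X ⊖ e ⊆? ⁅ c ⁆ ⊕* support ps))))))
          where
          i≤∣i∣ : ∀ i → i ℤ.≤ + ℤ.∣ i ∣
          i≤∣i∣ (+ i)        = ℤ.≤-refl
          i≤∣i∣ ℤ.-[1+ i ]   = ℤ.-≤+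

        contribution-positive : ∀ {X e} → (X , e) List.∈ incidences × 0ℤ ℤ.< contribution (X , e) →
          X List.∈ F × Active D (X , e) × ¬ (∏ ps (balance (X ⊖ e)) ℤ.≤ 0ℤ)
        contribution-positive {X} {e} (Xe∈incidences , 0<h) =
          proj₁ (∈-cartesianProduct⁻ F (allFin n) Xe∈incidences) , active , λ ∏≤0 →
          ℤ.<⇒≱ 0<h (ℤ.≤-trans
            (ℤ.≤-reflexive (trans (cong (_* δ) (⟦⟧-yes (active? D (X , e)) active)) (trans (ℤ.*-identityˡ δ) (Δ-mono (X ⊖ e) ⁅ c ⁆ ps fresh))))
            (*-nonpos-nonneg ∏≤0 (⟦⟧-nonneg (X ⊖ e ⊆? ⁅ c ⁆ ⊕* support ps))))
          where
          δ : ℤ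
          δ = Δ ps (mono (X ⊖ e)) ⁅ c ⁆
          active : Active D (X , e)
          active = decidable-stable (active? D (X , e)) λ ¬active →
            ℤ.<-irrefl (sym (trans (cong (_* δ) (⟦⟧-no (active? D (X , e)) ¬active)) (ℤ.*-zeroˡ δ))) 0<h

        Δ-vanishing : length ps ≡ d → Δ ps (vanishing D) ⁅ c ⁆ ≡ Δ ps (mono D) ⁅ c ⁆ - ∑ incidences contribution
        Δ-vanishing len = at-vanishing-incidences (gadget-functional fresh len) (Δ-low fresh len) D

      Δ-mono-⊆ : ∀ {T} → (∀ {x} → x ∈ T → x List.∈ support ps) → Δ ps (mono T) ⁅ c ⁆ ≡ ∏ ps (balance T)
      Δ-mono-⊆ {T} T⊆ = trans (Δ-mono T ⁅ c ⁆ ps fresh) (trans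
        (cong (∏ ps (balance T) *_) (⟦⟧-yes (T ⊆? _) (λ x∈ → ∈-⊕*⁺ ⁅ c ⁆ (T⊆ x∈))))
        (ℤ.*-identityʳ _))

  incidences! : Unique incidences
  incidences! = Unique.cartesianProduct⁺ F! (Unique.allFin⁺ n)

-- The exchange argument

module NoGadget {n d} (M : MissingTraces n d) (0<d : 0 < d)
  (K : Subset n) (room : 3 ℕ.+ d ℕ.+ suc d ≤ ∣ K ∣) (noGadget : ¬ Local.Gadget M K) where

  open MissingTraces M
  open Polynomials M
  open Local M

  outside-pick : ∀ (U : Subset n) {m} → ∣ U ∣ ≤ m → m ≤ 3 ℕ.+ d → ∃ λ z → z ∈ K × z ∉ U
  outside-pick U ∣U∣≤m m≤ = ∃∉ K U (ℕ.<-≤-trans (s≤s (ℕ.≤-trans ∣U∣≤m m≤))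
    (ℕ.≤-trans (ℕ.≤-trans (s≤s (ℕ.m≤m+n (3 ℕ.+ d) d)) (ℕ.≤-reflexive (sym (ℕ.+-suc (3 ℕ.+ d) d)))) room))

  -- One matching serves two alternating sums, over `(a , y) ∷ ps` and over `(z , y) ∷ ps`, hence
  -- freshness against `a`, `y` and `z` together. The first points of the former list are exactly
  -- the elements of `D`.
  record Frame (D : Subset n) (a y z : Fin n) : Set where
    field
      c       : Fin n
      ps      : Pairs n
      c∉      : c ∉ D ⊕ y ⊕ z
      firsts  : map proj₁ ps ≡ elements (D ⊖ a)
      fresh   : Fresh (⁅ c ⁆ ⊕ a ⊕ y ⊕ z) ps
      seconds : All (λ (_ , q) → q ∈ K × q ∉ D ⊕ y ⊕ z) ps

    firsts! : Unique (map proj₁ ps)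
    firsts! = subst Unique (sym firsts) (select-unique (_∈? (D ⊖ a)))

    ∈-firsts : ∀ {e} → e ∈ D → e ≢ a → e List.∈ map proj₁ ps
    ∈-firsts {e} e∈D e≢a = subst (e List.∈_) (sym firsts) (∈-select⁺ (_∈? (D ⊖ a)) (∈-⊖⁺ D e≢a e∈D))

    first-∈ : All (λ (p , _) → p ∈ D × p ≢ a) ps
    first-∈ = All.tabulate λ {pq} pq∈ →
      let p∈ = ∈-select⁻ (_∈? (D ⊖ a)) (subst (proj₁ pq List.∈_) firsts (∈-map⁺ proj₁ pq∈))
      in ⊖⊆ D a p∈ , ∈-⊖⁻ D p∈

  frame : ∀ {D a y z} → ∣ D ∣ ≡ d → a ∈ D → y ∉ D → z ∉ D ⊕ y → Frame D a y z
  frame {D} {a} {y} {z} ∣D∣ a∈D y∉D z∉D⊕y = record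
    { c = c ; ps = proj₁ m ; c∉ = c∉
    ; firsts = proj₁ (proj₂ m) ; fresh = proj₁ (proj₂ (proj₂ m))
    ; seconds = All.map (λ (q∈K , q∉) → q∈K , proj₂ (∉-⊕⁻ (D ⊕ y ⊕ z) q∉)) (proj₂ (proj₂ (proj₂ m))) }
    where
    ∣D⊕y⊕z∣ : ∣ D ⊕ y ⊕ z ∣ ≤ 2 ℕ.+ d
    ∣D⊕y⊕z∣ = ℕ.≤-trans (∣⊕∣≤ (D ⊕ y) z) (s≤s (ℕ.≤-trans (∣⊕∣≤ D y) (s≤s (ℕ.≤-reflexive ∣D∣))))
    picked = outside-pick (D ⊕ y ⊕ z) ∣D⊕y⊕z∣ (ℕ.n≤1+n _)
    c = proj₁ picked
    c∉ : c ∉ D ⊕ y ⊕ z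
    c∉ = proj₂ (proj₂ picked)
    U = D ⊕ y ⊕ z ⊕ c
    D⊆U : D ⊆ U
    D⊆U x∈ = ∈-⊕⁺ (D ⊕ y ⊕ z) c (∈-⊕⁺ (D ⊕ y) z (∈-⊕⁺ D y x∈))
    es = elements (D ⊖ a)
    es⁻ : ∀ {e} → e List.∈ es → e ∈ D ⊖ a
    es⁻ = ∈-select⁻ (_∈? (D ⊖ a))
    es∉X : ∀ {e} → e List.∈ es → e ∉ ⁅ c ⁆ ⊕ a ⊕ y ⊕ z
    es∉X {e} e∈ = ∉-⊕ (⁅ c ⁆ ⊕ a ⊕ y) (λ { refl → z∉D⊕y (∈-⊕⁺ D y e∈D) })
      (∉-⊕ (⁅ c ⁆ ⊕ a) (λ { refl → y∉D e∈D })
        (∉-⊕ ⁅ c ⁆ (∈-⊖⁻ D (es⁻ e∈))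
          (λ e∈c → c∉ (subst (_∈ D ⊕ y ⊕ z) (x∈⁅y⁆⇒x≡y c e∈c) (∈-⊕⁺ (D ⊕ y) z (∈-⊕⁺ D y e∈D))))))
      where
      e∈D : e ∈ D
      e∈D = ⊖⊆ D a (es⁻ e∈)
    X⊆U : ⁅ c ⁆ ⊕ a ⊕ y ⊕ z ⊆ U
    X⊆U = ⊕-⊆ (⁅ c ⁆ ⊕ a ⊕ y) (∈-⊕⁺ (D ⊕ y ⊕ z) c (∈-⊕-self (D ⊕ y) z))
      (⊕-⊆ (⁅ c ⁆ ⊕ a) (∈-⊕⁺ (D ⊕ y ⊕ z) c (∈-⊕⁺ (D ⊕ y) z (∈-⊕-self D y)))
        (⊕-⊆ ⁅ c ⁆ (D⊆U a∈D) (λ x∈c → subst (_∈ U) (sym (x∈⁅y⁆⇒x≡y c x∈c)) (∈-⊕-self (D ⊕ y ⊕ z) c))))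
    m = matching K U (⁅ c ⁆ ⊕ a ⊕ y ⊕ z) (select-unique (_∈? (D ⊖ a)))
      (All.tabulate es∉X) (All.tabulate (λ e∈ → D⊆U (⊖⊆ D a (es⁻ e∈)))) X⊆U
      (ℕ.≤-trans (ℕ.+-mono-≤ (ℕ.≤-trans (∣⊕∣≤ (D ⊕ y ⊕ z) c) (s≤s ∣D⊕y⊕z∣))
        (ℕ.≤-trans (ℕ.≤-reflexive (∣elements∣ (D ⊖ a))) (ℕ.≤-trans (ℕ.n≤1+n _)
          (ℕ.≤-trans (ℕ.≤-reflexive (trans (∣⊖∣ D a∈D) ∣D∣)) (ℕ.n≤1+n d))))) room)

  module _ {D a y z u} (∣D∣ : ∣ D ∣ ≡ d) (D⊆ : D ⊆ K ⊕ u) (a∈D : a ∈ D) (y∉D : y ∉ D) (z∈K : z ∈ K) (z∉D⊕y : z ∉ D ⊕ y)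
    (fr : Frame D a y z) where

    open Frame fr

    private
      z∉D : z ∉ D
      z∉D = proj₂ (∉-⊕⁻ D z∉D⊕y)

      z≢y : z ≢ y
      z≢y = proj₁ (∉-⊕⁻ D z∉D⊕y)

      in-D⊕y⊕z : ∀ {x} → x ∈ D ⊕ y ⊕ z → x ∉ ⁅ c ⁆
      in-D⊕y⊕z x∈ x∈c = c∉ (subst (_∈ D ⊕ y ⊕ z) (x∈⁅y⁆⇒x≡y c x∈c) x∈)

      length-suc-ps : suc (length ps) ≡ d
      length-suc-ps = trans (cong suc (trans (sym (length-map proj₁ ps)) (trans (cong length firsts) (∣elements∣ (D ⊖ a)))))
        (trans (∣⊖∣ D a∈D) ∣D∣)

      second-∉D : All (λ (_ , q) → q ∉ D) ps
      second-∉D = All.map (λ (_ , q∉) q∈D → q∉ (∈-⊕⁺ (D ⊕ y) z (∈-⊕⁺ D y q∈D))) seconds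

      second-∉D⊕y : All (λ (_ , q) → q ∉ D ⊕ y) ps
      second-∉D⊕y = All.map (λ (_ , q∉) q∈ → q∉ (∈-⊕⁺ (D ⊕ y) z q∈)) seconds

      K⊆ : ∀ {x} → x ∈ K → x ∈ K ⊕ u ⊕ y
      K⊆ x∈K = ∈-⊕⁺ (K ⊕ u) y (∈-⊕⁺ K u x∈K)

      D⊆′ : ∀ {x} → x ∈ D → x ∈ K ⊕ u ⊕ y
      D⊆′ x∈D = ∈-⊕⁺ (K ⊕ u) y (D⊆ x∈D)

      ps⊆ : All (_∈ K ⊕ u ⊕ y) (support ps)
      ps⊆ = support-∈ (All.zipWith (λ ((p∈D , _) , (q∈K , _)) → D⊆′ p∈D , K⊆ q∈K) (first-∈ , seconds))

      rest-nonneg : ∀ T → (∀ {p} → p ∈ D → p ≢ a → p ∈ T) → 0ℤ ℤ.≤ ∏ ps (balance T)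
      rest-nonneg T ⊆T = ∏-nonneg (All.map (λ { {p , q} (p∈D , p≢a) → balance-in T q (⊆T p∈D p≢a) }) first-∈)

    module _ {p : Fin n} (p∉T : p ∉ D ⊕ y ⊖ a) (fresh′ : Fresh ⁅ c ⁆ ((p , y) ∷ ps)) where

      -- `D ⊕ y ⊖ a` contains the second point of `(p , y)` and the first point of every other pair,
      -- so exactly one factor is -1. This is applied with p = a and with p = z.
      swapped : Δ ((p , y) ∷ ps) (mono (D ⊕ y ⊖ a)) ⁅ c ⁆ ≡ -1ℤ
      swapped = trans (Δ-mono-⊆ D c ((p , y) ∷ ps) fresh′ cover)
        (cong₂ _*_ (balance-out-in T p∉T (∈-⊖⁺ (D ⊕ y) (λ { refl → y∉D a∈D }) (∈-⊕-self D y)))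
          (∏-one (balance T) {ps} (All.zipWith (λ { {p , q} ((p∈D , p≢a) , q∉) →
            balance-in-out T {p} {q} (∈-⊖⁺ (D ⊕ y) p≢a (∈-⊕⁺ D y p∈D)) (λ q∈ → q∉ (⊖⊆ (D ⊕ y) a q∈)) }) (first-∈ , second-∉D⊕y))))
        where
        T = D ⊕ y ⊖ a
        cover : ∀ {x} → x ∈ T → x List.∈ support ((p , y) ∷ ps)
        cover x∈ with ∈-⊕⁻ D y (⊖⊆ (D ⊕ y) a x∈)
        ... | inj₁ refl = there (here refl)
        ... | inj₂ x∈D  = there (there (firsts⊆support ps (∈-firsts x∈D (∈-⊖⁻ (D ⊕ y) x∈))))

      swapped-contribution : D ⊕ y List.∈ F → a ∉ B (D ⊕ y) →
        contribution D c ((p , y) ∷ ps) (D ⊕ y , a) ≡ -1ℤ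
      swapped-contribution Y∈F a∉B = trans
        (contribution-active D c ((p , y) ∷ ps) ((λ x∈ → ∈-⊕⁺ D y x∈) , ∈-⊕⁺ D y a∈D , a∉B)) swapped

      -- A nonzero difference would be a gadget, with `y` in the role of `v`.
      vanishes : p ∈ K ⊕ u ⊕ y →
        Δ ((p , y) ∷ ps) (mono D) ⁅ c ⁆ ≡ ∑ incidences (contribution D c ((p , y) ∷ ps))
      vanishes p∈ = ℤ.i-j≡0⇒i≡j _ _ (trans (sym (Δ-vanishing D c ((p , y) ∷ ps) fresh′ length-suc-ps))
        (decidable-stable (_ ℤ.≟ 0ℤ) (λ nonzero → noGadget record
          { D = D ; ps = (p , y) ∷ ps ; c = c ; u = u ; v = y ; D⊆ = D⊆ ; ∣D∣ = ∣D∣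
          ; ps⊆ = p∈ ∷ ∈-⊕-self (K ⊕ u) y ∷ ps⊆
          ; length-ps = length-suc-ps ; fresh = fresh′ ; nonzero = nonzero })))

    private
      a∉T : a ∉ D ⊕ y ⊖ a
      a∉T = ∉-⊖-self (D ⊕ y) a

      fresh-a : Fresh ⁅ c ⁆ ((a , y) ∷ ps)
      fresh-a = in-D⊕y⊕z (∈-⊕⁺ (D ⊕ y) z (∈-⊕⁺ D y a∈D)) , in-D⊕y⊕z (∈-⊕⁺ (D ⊕ y) z (∈-⊕-self D y))
        , (λ { refl → y∉D a∈D }) , Fresh-⊆ ps (∈-⊕⁺ (⁅ c ⁆ ⊕ a ⊕ y) z) fresh

      z∉T : z ∉ D ⊕ y ⊖ a
      z∉T z∈ = z∉D⊕y (⊖⊆ (D ⊕ y) a z∈)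

      fresh-z : Fresh ⁅ c ⁆ ((z , y) ∷ ps)
      fresh-z = in-D⊕y⊕z (∈-⊕-self (D ⊕ y) z) , in-D⊕y⊕z (∈-⊕⁺ (D ⊕ y) z (∈-⊕-self D y)) , z≢y
        , Fresh-⊆ ps (⊕-⊆ (⁅ c ⁆ ⊕ z) (∈-⊕⁺ (⁅ c ⁆ ⊕ a ⊕ y) z (∈-⊕-self (⁅ c ⁆ ⊕ a) y))
            (⊕-⊆ ⁅ c ⁆ (∈-⊕-self (⁅ c ⁆ ⊕ a ⊕ y) z) (λ x∈ → ∈-⊕⁺ (⁅ c ⁆ ⊕ a ⊕ y) z (∈-⊕⁺ (⁅ c ⁆ ⊕ a) y (∈-⊕⁺ ⁅ c ⁆ a x∈))))) fresh

      sum≡1 : ∑ incidences (contribution D c ((a , y) ∷ ps)) ≡ 1ℤ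
      sum≡1 = trans (sym (vanishes a∉T fresh-a (D⊆′ a∈D))) (trans (Δ-mono-⊆ D c ((a , y) ∷ ps) fresh-a cover)
        (∏-one (balance D) {(a , y) ∷ ps} (balance-in-out D {a} {y} a∈D y∉D ∷ All.zipWith (λ { {p , q} ((p∈D , _) , q∉D) → balance-in-out D {p} {q} p∈D q∉D }) (first-∈ , second-∉D))))
        where
        cover : ∀ {x} → x ∈ D → x List.∈ support ((a , y) ∷ ps)
        cover {x} x∈D with x Fin.≟ a
        ... | yes refl = here refl
        ... | no  x≢a  = there (there (firsts⊆support ps (∈-firsts x∈D x≢a)))

      -- Dropping a vertex of `D` from `X` leaves a product at most 0, so `e` must be the one vertex
      -- of `X` beyond `D`.
      positive⇒extends : ∀ {X e} → (X , e) List.∈ incidences × 0ℤ ℤ.< contribution D c ((a , y) ∷ ps) (X , e) →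
        Extends D e × X ≡ D ⊕ e
      positive⇒extends {X} {e} Xe∈ with contribution-positive D c ((a , y) ∷ ps) fresh-a Xe∈
      ... | X∈F , (D⊆X , e∈X , e∉B) , ∏≰0 with e ∈? D
      ...   | no e∉D = (e∉D , subst (List._∈ F) (sym D⊕e≡X) X∈F , subst (λ Y → e ∉ B Y) (sym D⊕e≡X) e∉B) , sym D⊕e≡X
        where
        D⊕e≡X : D ⊕ e ≡ X
        D⊕e≡X = superset ∣D∣ X∈F D⊆X e∈X e∉D
      ...   | yes e∈D = contradiction (∏-balance-nonpos (X ⊖ e) ((a , y) ∷ ps)
          (All.tabulate (λ p∈ a≡p → ∈-⊖⁻ D (∈-select⁻ (_∈? (D ⊖ a)) (subst (_ List.∈_) firsts p∈)) (sym a≡p)) ∷ firsts!)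
          (∉-⊖-self X e)
          ((λ a≢e → ∈-⊖⁺ X a≢e (D⊆X a∈D)) ∷ All.map (λ (p∈D , _) p≢e → ∈-⊖⁺ X p≢e (D⊆X p∈D)) first-∈)
          e∈firsts) ∏≰0
        where
        e∈firsts : e List.∈ a ∷ map proj₁ ps
        e∈firsts with e Fin.≟ a
        ... | yes e≡a = here e≡a
        ... | no  e≢a = there (∈-firsts e∈D e≢a)

    frame-extension : ∃ (Extends D)
    frame-extension =
      let (_ , e) , pos = positive-term {xs = incidences} {f = contribution D c ((a , y) ∷ ps)} (contribution≤1 D c ((a , y) ∷ ps) fresh-a) sum≡1
      in e , proj₁ (positive⇒extends pos)

    module _ (Y∈F : D ⊕ y List.∈ F) (a∉B : a ∉ B (D ⊕ y)) where

      private
        incidence : (D ⊕ y , a) List.∈ incidences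
        incidence = ∈-cartesianProduct⁺ Y∈F (∈-allFin a)

      -- The incidence `(D ⊕ y , a)` contributes -1, so a total of 1 needs two positive terms.
      frame-two-extensions : TwoExtensions D
      frame-two-extensions = extend (two-positive-terms {xs = incidences} {f = contribution D c ((a , y) ∷ ps)} (contribution≤1 D c ((a , y) ∷ ps) fresh-a) incidences!
        incidence (swapped-contribution a∉T fresh-a Y∈F a∉B) sum≡1)
        where
        extend : (∃₂ λ Xe Yf → Xe ≢ Yf × (Xe List.∈ incidences × 0ℤ ℤ.< contribution D c ((a , y) ∷ ps) Xe)
                                       × (Yf List.∈ incidences × 0ℤ ℤ.< contribution D c ((a , y) ∷ ps) Yf)) → TwoExtensions D
        extend ((X , e) , (X′ , f) , Xe≢ , pos , pos′) =
          let e-extends , X≡  = positive⇒extends pos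
              f-extends , X′≡ = positive⇒extends pos′
          in e , f , (λ e≡f → Xe≢ (cong₂ _,_ (trans X≡ (trans (cong (D ⊕_) e≡f) (sym X′≡))) e≡f)) , e-extends , f-extends

      sum≡0 : ∑ incidences (contribution D c ((z , y) ∷ ps)) ≡ 0ℤ
      sum≡0 = trans (sym (vanishes z∉T fresh-z (K⊆ z∈K)))
        (Δ-misses (λ b∉D → mono-insert-∉ D b∉D) ((z , y) ∷ ps) (here (z∉D , y∉D)) ⁅ c ⁆)

      -- With `z` in place of `a` in the first pair the total is 0, as `D` contains neither `z` nor
      -- `y`, while `(D ⊕ y , a)` still contributes -1. The compensating positive term has to
      -- contain `z`.
      frame-transfer : D ⊕ z List.∈ F
      frame-transfer =
        let (X , e) , pos = compensating-term {xs = incidences} {f = contribution D c ((z , y) ∷ ps)} (contribution≤1 D c ((z , y) ∷ ps) fresh-z)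
              incidence (swapped-contribution z∉T fresh-z Y∈F a∉B) sum≡0
            X∈F , (D⊆X , _) , ∏≰0 = contribution-positive D c ((z , y) ∷ ps) fresh-z pos
        in subst (List._∈ F) (sym (superset ∣D∣ X∈F D⊆X (z∈X X∈F D⊆X ∏≰0) z∉D)) X∈F
        where
        z∈X : ∀ {X e} → X List.∈ F → D ⊆ X → ¬ (∏ ((z , y) ∷ ps) (balance (X ⊖ e)) ℤ.≤ 0ℤ) → z ∈ X
        z∈X {X} {e} X∈F D⊆X ∏≰0 = decidable-stable (z ∈? X) λ z∉X →
          ∏≰0 (∏≤0 (λ z∈ → z∉X (⊖⊆ X e z∈)) (y ∈? T) ((e ∈? D) ×-dec ¬? (e Fin.≟ a)))
          where
          T = X ⊖ e
          -- Without `z` the first balance is at most 0, and if it is not 0 then X = D ⊕ y. If `e`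
          -- is an element of `D` other than `a`, its pair has balance 0 because its partner is not
          -- in `X` either; otherwise all remaining factors are nonnegative.
          ∏≤0 : z ∉ T → Dec (y ∈ T) → Dec (e ∈ D × e ≢ a) → ∏ ((z , y) ∷ ps) (balance T) ℤ.≤ 0ℤ
          ∏≤0 z∉T (no y∉T) _ = ℤ.≤-reflexive (∏-zero {xs = (z , y) ∷ ps} {balance T} (here refl) (balance-out-out T z∉T y∉T))
          ∏≤0 z∉T (yes y∈T) (no ¬e) = *-nonpos-nonneg (balance-out T y z∉T)
            (rest-nonneg T (λ p∈D p≢a → ∈-⊖⁺ X (λ { refl → ¬e (p∈D , p≢a) }) (D⊆X p∈D)))
          ∏≤0 z∉T (yes y∈T) (yes (e∈D , e≢a)) with ∈-map⁻ proj₁ (∈-firsts e∈D e≢a)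
          ... | (_ , q) , pq∈ , refl = ℤ.≤-reflexive (∏-zero {xs = (z , y) ∷ ps} {balance T} (there pq∈)
                  (balance-out-out T (∉-⊖-self X e) (λ q∈T → All.lookup second-∉D⊕y pq∈
                    (subst (q ∈_) (sym (superset ∣D∣ X∈F D⊆X (⊖⊆ X e y∈T) y∉D)) (⊖⊆ X e q∈T)))))

  ∃∈ : ∀ {D : Subset n} → ∣ D ∣ ≡ d → ∃ λ a → a ∈ D
  ∃∈ {D} ∣D∣ = let a , a∈D , _ = ∃∉ D Sub.⊥ (subst₂ _<_ (sym (∣⊥∣≡0 n)) (sym ∣D∣) 0<d) in a , a∈D

  ∣⊕∣≤1+d : ∀ {D : Subset n} → ∣ D ∣ ≡ d → ∀ y → ∣ D ⊕ y ∣ ≤ suc d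
  ∣⊕∣≤1+d {D} ∣D∣ y = ℕ.≤-trans (∣⊕∣≤ D y) (s≤s (ℕ.≤-reflexive ∣D∣))

  fresh-vertex : ∀ {D : Subset n} → ∣ D ∣ ≡ d → ∀ y → ∃ λ z → z ∈ K × z ∉ D ⊕ y
  fresh-vertex {D} ∣D∣ y = outside-pick (D ⊕ y) (∣⊕∣≤1+d {D} ∣D∣ y) (s≤s (ℕ.m≤n+m d 2))

  extension : ∀ {D u} → ∣ D ∣ ≡ d → D ⊆ K ⊕ u → ∃ (Extends D)
  extension {D} ∣D∣ D⊆ =
    let a , a∈D       = ∃∈ {D} ∣D∣
        y , _ , y∉D   = outside-pick D (ℕ.≤-reflexive ∣D∣) (ℕ.m≤n+m d 3)
        z , z∈K , z∉  = fresh-vertex {D} ∣D∣ y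
    in frame-extension ∣D∣ D⊆ a∈D y∉D z∈K z∉ (frame ∣D∣ a∈D y∉D z∉)

  -- The only other way for `B (D ⊕ y)` to contain `D` is to be all of `D ⊕ y`, a trace that `D ⊕ y`
  -- itself realises.
  deficient : ∀ {D y} → D ⊕ y List.∈ F → B (D ⊕ y) ≢ D → ∃ λ a → a ∈ D × a ∉ B (D ⊕ y)
  deficient {D} {y} Y∈F B≢D = ⊈⇒∃ D (B (D ⊕ y)) D⊈B
    where
    D⊈B : ¬ D ⊆ B (D ⊕ y)
    D⊈B D⊆B with y ∈? B (D ⊕ y)
    ... | yes y∈B = missing Y∈F Y∈F (trans (∩-idem (D ⊕ y)) (⊆-antisym (⊕-⊆ D y∈B D⊆B) (B⊆ Y∈F)))
    ... | no  y∉B = B≢D (⊆-antisym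
          (λ x∈B → Sum.[ (λ { refl → contradiction x∈B y∉B }) , (λ x∈D → x∈D) ] (∈-⊕⁻ D y (B⊆ Y∈F x∈B)))
          D⊆B)

  module _ {D u y} (∣D∣ : ∣ D ∣ ≡ d) (D⊆ : D ⊆ K ⊕ u) (y∉D : y ∉ D) (Y∈F : D ⊕ y List.∈ F) (B≢D : B (D ⊕ y) ≢ D) where

    -- `B≢D` supplies, through `deficient`, the vertex whose removal produces the term -1.
    transfer : ∀ {z} → z ∈ K → z ∉ D → D ⊕ z List.∈ F
    transfer {z} z∈K z∉D with z Fin.≟ y
    ... | yes refl = Y∈F
    ... | no  z≢y  =
      let a , a∈D , a∉B = deficient Y∈F B≢D
          z∉ = ∉-⊕ D z≢y z∉D
      in frame-transfer ∣D∣ D⊆ a∈D y∉D z∈K z∉ (frame ∣D∣ a∈D y∉D z∉) Y∈F a∉B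

    two-extensions : TwoExtensions D
    two-extensions =
      let a , a∈D , a∉B = deficient Y∈F B≢D
          z , z∈K , z∉  = fresh-vertex {D} ∣D∣ y
      in frame-two-extensions ∣D∣ D⊆ a∈D y∉D z∈K z∉ (frame ∣D∣ a∈D y∉D z∉) Y∈F a∉B

  ∩-⊕ : ∀ {D : Subset n} {y z} → y ≢ z → y ∉ D → (D ⊕ z) ∩ (D ⊕ y) ≡ D
  ∩-⊕ {D} {y} {z} y≢z y∉D = ⊆-antisym
    (λ x∈ → Sum.[ (λ { refl → Sum.[ (λ y≡z → contradiction y≡z y≢z) , (λ y∈D → y∈D) ] (∈-⊕⁻ D z (p∩q⊆p (D ⊕ z) (D ⊕ y) x∈)) })
                , (λ x∈D → x∈D) ] (∈-⊕⁻ D y (p∩q⊆q (D ⊕ z) (D ⊕ y) x∈)))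
    (λ x∈D → x∈p∩q⁺ (∈-⊕⁺ D z x∈D , ∈-⊕⁺ D y x∈D))

  -- Two members over the same `D` intersect exactly in `D`, so `D` is a realised trace on each of
  -- them.
  trace≢ : ∀ {D y z} → y ≢ z → y ∉ D → D ⊕ y List.∈ F → D ⊕ z List.∈ F → B (D ⊕ y) ≢ D
  trace≢ y≢z y∉D Y∈F Z∈F B≡D = missing Y∈F Z∈F (trans (∩-⊕ y≢z y∉D) (sym B≡D))

  -- All facets of H = D ⊕ e are exchangeable, so every set obtained from H by
  -- trading vertices for vertices of K lies in F and H has no missing trace.
  no-two-extensions : ∀ {D} → ∣ D ∣ ≡ d → D ⊆ K → ¬ TwoExtensions D
  no-two-extensions {D} ∣D∣ D⊆K (e , f , e≢f , (e∉D , H∈F , e∉B) , (f∉D , H′∈F , _)) =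
    missing H∈F (exchanged (B H) A! A∈K A∉H (B⊆ H∈F) (trans (cong (∣ B H ∣ ℕ.+_) ∣A∣) (∣B∣+∣rest∣ H∈F)))
      (⊆-antisym
        (λ x∈ → Sum.[ (λ x∈B → x∈B)
                    , (λ x∈A → contradiction (p∩q⊆q (B H ⊕* A) H x∈) (All.lookup A∉H x∈A)) ]
                    (∈-⊕*⁻ (B H) A (p∩q⊆p (B H ⊕* A) H x∈)))
        (λ x∈B → x∈p∩q⁺ (⊆-⊕* (B H) A x∈B , B⊆ H∈F x∈B)))
    where
    H = D ⊕ e

    ∣H∣ : ∣ H ∣ ≡ suc d
    ∣H∣ = size H∈F

    H⊆ : H ⊆ K ⊕ e
    H⊆ = ⊕-mono D D⊆K

    -- A facet through `e` differs from `B H` because `e` is not in `B H`; the remaining facet is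
    -- `D`, which `D ⊕ f` cuts out of `H`.
    facet≢B : ∀ {T g} → T ⊕ g ≡ H → g ∉ T → B H ≢ T
    facet≢B {T} {g} T⊕g≡H g∉T B≡T with e ∈? T
    ... | yes e∈T = e∉B (subst (e ∈_) (sym B≡T) e∈T)
    ... | no  e∉T = trace≢ e≢f e∉D H∈F H′∈F (trans B≡T (⊆-∣∣-≡ T⊆D (ℕ.≤-reflexive ∣D∣≡∣T∣)))
      where
      T⊆D : T ⊆ D
      T⊆D {x} x∈T with ∈-⊕⁻ D e (subst (x ∈_) T⊕g≡H (∈-⊕⁺ T g x∈T))
      ... | inj₁ refl = contradiction x∈T e∉T
      ... | inj₂ x∈D  = x∈D
      ∣D∣≡∣T∣ : ∣ D ∣ ≡ ∣ T ∣
      ∣D∣≡∣T∣ = ℕ.suc-injective (trans (sym (∣⊕∣ D e∉D)) (trans (cong ∣_∣ (sym T⊕g≡H)) (∣⊕∣ T g∉T)))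

    exchanged : ∀ T {A} → Unique A → All (_∈ K) A → All (_∉ H) A → T ⊆ H → ∣ T ∣ ℕ.+ length A ≡ suc d →
                T ⊕* A List.∈ F
    exchanged T [] [] [] T⊆H ∣T∣ = subst (List._∈ F)
      (sym (⊆-∣∣-≡ T⊆H (ℕ.≤-reflexive (trans ∣H∣ (trans (sym ∣T∣) (ℕ.+-identityʳ ∣ T ∣)))))) H∈F
    exchanged T {z ∷ []} _ (z∈K ∷ _) (z∉H ∷ _) T⊆H ∣T∣+1 =
      let g , g∈H , g∉T = ∃∉ H T (ℕ.≤-reflexive (trans (cong suc ∣T∣) (sym ∣H∣)))
          T⊕g≡H = superset ∣T∣ H∈F T⊆H g∈H g∉T
      in transfer {u = e} ∣T∣ (λ x∈ → H⊆ (T⊆H x∈)) g∉T (subst (List._∈ F) (sym T⊕g≡H) H∈F)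
           (λ B≡T → facet≢B T⊕g≡H g∉T (trans (cong B (sym T⊕g≡H)) B≡T)) z∈K (λ z∈T → z∉H (T⊆H z∈T))
      where
      ∣T∣ : ∣ T ∣ ≡ d
      ∣T∣ = ℕ.suc-injective (trans (ℕ.+-comm 1 ∣ T ∣) ∣T∣+1)
    -- `T` lacks at least two vertices of `H`. Adding either one to `T ⊕* A` gives a member by
    -- induction, and two members over the same set make it exchangeable.
    exchanged T {z ∷ A@(z′ ∷ A′)} (z∉A ∷ A!) (z∈K ∷ A∈K) (z∉H ∷ A∉H) T⊆H ∣T∣+∣A∣ =
      let g , g∈H , g∉T = ∃∉ H T ∣T∣<∣H∣
          h , h∈H , h∉T⊕g = ∃∉ H (T ⊕ g) (ℕ.≤-<-trans (∣⊕∣≤ T g) 1+∣T∣<∣H∣)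
          h≢g , h∉T = ∉-⊕⁻ T h∉T⊕g
          G∈F = with-vertex g∈H g∉T
      in subst (List._∈ F) (sym (⊕*-comm T z A))
           (transfer {u = e} ∣T⊕A∣ T⊕A⊆ (∉T⊕A g∈H g∉T) G∈F (trace≢ (h≢g ∘ sym) (∉T⊕A g∈H g∉T) G∈F (with-vertex h∈H h∉T))
             z∈K (λ z∈ → Sum.[ (λ z∈T → z∉H (T⊆H z∈T)) , (λ z∈A → All.lookup z∉A z∈A refl) ] (∈-⊕*⁻ T A z∈)))
      where
      ∣T∣+∣A∣′ : ∣ T ∣ ℕ.+ length A ≡ d
      ∣T∣+∣A∣′ = ℕ.suc-injective (trans (sym (ℕ.+-suc ∣ T ∣ (length A))) ∣T∣+∣A∣)
      1+∣T∣<∣H∣ : suc ∣ T ∣ < ∣ H ∣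
      1+∣T∣<∣H∣ = subst (suc ∣ T ∣ <_) (trans (cong suc ∣T∣+∣A∣′) (sym ∣H∣)) (s≤s (ℕ.m<m+n ∣ T ∣ (s≤s z≤n)))
      ∣T∣<∣H∣ : ∣ T ∣ < ∣ H ∣
      ∣T∣<∣H∣ = ℕ.<-trans (ℕ.n<1+n _) 1+∣T∣<∣H∣
      ∣T⊕A∣ : ∣ T ⊕* A ∣ ≡ d
      ∣T⊕A∣ = trans (∣⊕*∣ T A! (All.map (λ x∉H x∈T → x∉H (T⊆H x∈T)) A∉H)) ∣T∣+∣A∣′
      T⊕A⊆ : T ⊕* A ⊆ K ⊕ e
      T⊕A⊆ x∈ = Sum.[ (λ x∈T → H⊆ (T⊆H x∈T)) , (λ x∈A → ∈-⊕⁺ K e (All.lookup A∈K x∈A)) ] (∈-⊕*⁻ T A x∈)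
      ∉T⊕A : ∀ {g} → g ∈ H → g ∉ T → g ∉ T ⊕* A
      ∉T⊕A g∈H g∉T g∈ = Sum.[ g∉T , (λ g∈A → All.lookup A∉H g∈A g∈H) ] (∈-⊕*⁻ T A g∈)
      with-vertex : ∀ {g} → g ∈ H → g ∉ T → T ⊕* A ⊕ g List.∈ F
      with-vertex {g} g∈H g∉T = subst (List._∈ F) (⊕*-comm T g A)
        (exchanged (T ⊕ g) A! A∈K A∉H (⊕-⊆ T g∈H T⊆H)
          (trans (cong (ℕ._+ length A) (∣⊕∣ T g∉T)) (cong suc ∣T∣+∣A∣′)))

    picked = pick K H (length (rest H)) (ℕ.≤-trans
      (ℕ.+-mono-≤ (ℕ.≤-reflexive ∣H∣) (ℕ.≤-trans (ℕ.m≤n+m _ ∣ B H ∣) (ℕ.≤-reflexive (∣B∣+∣rest∣ H∈F))))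
      (ℕ.≤-trans (ℕ.m≤n+m _ 2) room))
    A = proj₁ picked
    A! : Unique A
    A! = proj₁ (proj₂ picked)
    A∈K : All (_∈ K) A
    A∈K = proj₁ (proj₂ (proj₂ picked))
    A∉H : All (_∉ H) A
    A∉H = proj₁ (proj₂ (proj₂ (proj₂ picked)))
    ∣A∣ : length A ≡ length (rest H)
    ∣A∣ = proj₂ (proj₂ (proj₂ (proj₂ picked)))

  -- Two members over `D` make `D` exchangeable by `trace≢`, which upgrades them to extensions whose
  -- new vertex is outside the missing trace.
  no-branching : ∀ {D y z} → ∣ D ∣ ≡ d → D ⊆ K → y ≢ z → y ∉ D → D ⊕ y List.∈ F → D ⊕ z List.∈ F → Empty.⊥
  no-branching {D} {y} ∣D∣ D⊆K y≢z y∉D Y∈F Z∈F = no-two-extensions ∣D∣ D⊆K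
    (two-extensions {u = y} ∣D∣ (λ x∈ → ∈-⊕⁺ K y (D⊆K x∈)) y∉D Y∈F (trace≢ y≢z y∉D Y∈F Z∈F))

  -- If B (D₀ ⊕ y) = D₀, moving the hole from y to e ∈ D₀ makes the facet
  -- D₀ ⊖ e ⊕ y exchangeable, and then some set D₀ ⊖ e ⊕ z in K extends by both y and u.
  no-extension : ∀ {D₀ y e} → ∣ D₀ ∣ ≡ d → D₀ ⊆ K → y ∉ D₀ → D₀ ⊕ y List.∈ F → e ∈ D₀ → Empty.⊥
  no-extension {D₀} {y} {e} ∣D₀∣ D₀⊆K y∉D₀ Y∈F e∈D₀ = cases (≡-dec Bool._≟_ (B (D₀ ⊕ y)) D₀)
    where
    E = D₀ ⊖ e
    y∉E : y ∉ E
    y∉E y∈ = y∉D₀ (⊖⊆ D₀ e y∈)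
    E⊆K : E ⊆ K
    E⊆K x∈ = D₀⊆K (⊖⊆ D₀ e x∈)
    ∣E⊕∣ : ∀ {x} → x ∉ E → ∣ E ⊕ x ∣ ≡ d
    ∣E⊕∣ x∉E = trans (∣⊕∣ E x∉E) (trans (∣⊖∣ D₀ e∈D₀) ∣D₀∣)
    D = E ⊕ y
    e∉D : e ∉ D
    e∉D = ∉-⊕ E (λ { e≡y → y∉D₀ (subst (_∈ D₀) e≡y e∈D₀) }) (∉-⊖-self D₀ e)
    D⊕e≡ : D ⊕ e ≡ D₀ ⊕ y
    D⊕e≡ = trans (⊕-comm E y e) (cong (_⊕ y) (⊖-⊕ D₀ e∈D₀))
    D⊆ : D ⊆ K ⊕ y
    D⊆ = ⊕-mono E E⊆K
    D⊕e∈F : D ⊕ e List.∈ F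
    D⊕e∈F = subst (List._∈ F) (sym D⊕e≡) Y∈F

    cases : Dec (B (D₀ ⊕ y) ≡ D₀) → Empty.⊥
    cases (no B≢D₀) = no-two-extensions ∣D₀∣ D₀⊆K
      (two-extensions {u = y} ∣D₀∣ (λ x∈ → ∈-⊕⁺ K y (D₀⊆K x∈)) y∉D₀ Y∈F B≢D₀)
    cases (yes B≡D₀) = finish (two-extensions {u = y} (∣E⊕∣ y∉E) D⊆ e∉D D⊕e∈F B≢D)
      where
      B≢D : B (D ⊕ e) ≢ D
      B≢D B≡D = e∉D (subst (e ∈_) (trans (sym B≡D₀) (trans (cong B (sym D⊕e≡)) B≡D)) e∈D₀)
      finish : TwoExtensions D → Empty.⊥
      finish (u , _ , _ , (u∉D , H∈F , u∉B) , _) =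
        -- The member `E ⊕ y ⊕ u` is read over `E ⊕ u`, where `u ∉ B` permits trading `y` for `z`;
        -- the member `D ⊕ e` is read over `D`, where `e` is traded for `z`.
        no-branching {E ⊕ z} {u} {y} (∣E⊕∣ z∉E) (⊕-⊆ E z∈K E⊆K) u≢y
          (∉-⊕ E (λ { u≡z → proj₁ (∉-⊕⁻ (D₀ ⊕ y) z∉) (sym u≡z) }) u∉E)
          (subst (List._∈ F) (⊕-comm E u z)
            (transfer {u = u} (∣E⊕∣ u∉E) (⊕-mono E E⊆K) y∉E⊕u (subst (List._∈ F) (⊕-comm E y u) H∈F)
              (λ B≡ → u∉B (subst (u ∈_) (sym (trans (cong B (⊕-comm E y u)) B≡)) (∈-⊕-self E u)))
              z∈K (∉-⊕ E z≢u z∉E)))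
          (subst (List._∈ F) (⊕-comm E y z)
            (transfer {u = y} (∣E⊕∣ y∉E) D⊆ e∉D D⊕e∈F B≢D z∈K (∉-⊕ E z≢y z∉E)))
        where
        picked = outside-pick (D₀ ⊕ y ⊕ u)
          (ℕ.≤-trans (∣⊕∣≤ (D₀ ⊕ y) u) (s≤s (∣⊕∣≤1+d {D₀} ∣D₀∣ y))) (ℕ.n≤1+n _)
        z = proj₁ picked
        z∈K : z ∈ K
        z∈K = proj₁ (proj₂ picked)
        z∉ : z ∉ D₀ ⊕ y ⊕ u
        z∉ = proj₂ (proj₂ picked)
        z≢u : z ≢ u
        z≢u = proj₁ (∉-⊕⁻ (D₀ ⊕ y) z∉)
        z≢y : z ≢ y
        z≢y = proj₁ (∉-⊕⁻ D₀ (proj₂ (∉-⊕⁻ (D₀ ⊕ y) z∉)))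
        z∉E : z ∉ E
        z∉E z∈ = proj₂ (∉-⊕⁻ D₀ (proj₂ (∉-⊕⁻ (D₀ ⊕ y) z∉))) (⊖⊆ D₀ e z∈)
        u∉E : u ∉ E
        u∉E = proj₂ (∉-⊕⁻ E u∉D)
        u≢y : u ≢ y
        u≢y = proj₁ (∉-⊕⁻ E u∉D)
        y∉E⊕u : y ∉ E ⊕ u
        y∉E⊕u = ∉-⊕ E (u≢y ∘ sym) y∉E

  impossible : Empty.⊥
  impossible =
    let zs , zs! , zs∈K , zs∉⊥ , length-zs = pick K Sub.⊥ d (ℕ.≤-trans (ℕ.≤-reflexive (cong (ℕ._+ d) (∣⊥∣≡0 n)))
          (ℕ.≤-trans (ℕ.m≤n+m d (3 ℕ.+ d)) (ℕ.≤-trans (ℕ.+-monoʳ-≤ (3 ℕ.+ d) (ℕ.n≤1+n d)) room)))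
        ∣D₀∣ = trans (∣⊕*∣ Sub.⊥ zs! zs∉⊥) (cong₂ ℕ._+_ (∣⊥∣≡0 n) length-zs)
        D₀⊆K : Sub.⊥ ⊕* zs ⊆ K
        D₀⊆K = λ x∈ → Sum.[ (λ x∈⊥ → contradiction x∈⊥ ∉⊥) , All.lookup zs∈K ] (∈-⊕*⁻ Sub.⊥ zs x∈)
        e , e∈D₀ = ∃∈ {Sub.⊥ ⊕* zs} ∣D₀∣
        _ , y∉D₀ , Y∈F , _ = extension {u = e} ∣D₀∣ (λ x∈ → ∈-⊕⁺ K e (D₀⊆K x∈))
    in no-extension ∣D₀∣ D₀⊆K y∉D₀ Y∈F e∈D₀

-- Independence of the functionals

subsetsOfSize : ∀ n → ℕ → List (Subset n)
subsetsOfSize zero    zero    = [] ∷ []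
subsetsOfSize zero    (suc k) = []
subsetsOfSize (suc n) zero    = Sub.⊥ ∷ []
subsetsOfSize (suc n) (suc k) = map (inside ∷_) (subsetsOfSize n k) ++ map (outside ∷_) (subsetsOfSize n (suc k))

length-subsetsOfSize : ∀ n k → length (subsetsOfSize n k) ≡ n C k
length-subsetsOfSize zero    zero    = refl
length-subsetsOfSize zero    (suc k) = refl
length-subsetsOfSize (suc n) zero    = refl
length-subsetsOfSize (suc n) (suc k) = begin
  length (map (inside ∷_) (subsetsOfSize n k) ++ map (outside ∷_) (subsetsOfSize n (suc k)))
    ≡⟨ length-++ (map (inside ∷_) (subsetsOfSize n k)) ⟩
  length (map (inside ∷_) (subsetsOfSize n k)) ℕ.+ length (map (outside ∷_) (subsetsOfSize n (suc k)))
    ≡⟨ cong₂ ℕ._+_ (trans (length-map (inside ∷_) (subsetsOfSize n k)) (length-subsetsOfSize n k))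
                   (trans (length-map (outside ∷_) (subsetsOfSize n (suc k))) (length-subsetsOfSize n (suc k))) ⟩
  n C k ℕ.+ n C suc k
    ≡⟨ nCk+nC[k+1]≡[n+1]C[k+1] n k ⟩
  suc n C suc k ∎
  where open ≡-Reasoning

∈-subsetsOfSize : ∀ {n} k (S : Subset n) → ∣ S ∣ ≡ k → S List.∈ subsetsOfSize n k
∈-subsetsOfSize zero    []            refl = here refl
∈-subsetsOfSize {suc n} zero S ∣S∣ = here (sym (⊆-∣∣-≡ (⊥⊆ {p = S}) (ℕ.≤-trans (ℕ.≤-reflexive ∣S∣) z≤n)))
∈-subsetsOfSize (suc k) (inside  ∷ S) eq   = ∈-++⁺ˡ (∈-map⁺ (inside ∷_) (∈-subsetsOfSize k S (ℕ.suc-injective eq)))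
∈-subsetsOfSize {suc n} (suc k) (outside ∷ S) eq =
  ∈-++⁺ʳ (map (inside ∷_) (subsetsOfSize n k)) (∈-map⁺ (outside ∷_) (∈-subsetsOfSize (suc k) S eq))

evaluation : {k : ℕ} (X : Subset n) → ∣ X ∣ ≡ k → Functional n k
evaluation X ∣X∣ = record
  { at = λ f → f X ; at-cong = λ f≗g → f≗g X ∣X∣ ; at-+ = λ _ _ → refl ; at-* = λ _ _ → refl }

linearCombination : {k m : ℕ} → (Fin m → ℤ) → (Fin m → Functional n k) → Functional n k
linearCombination x φ = record
  { at      = λ f → sum (λ j → at (φ j) f * x j)
  ; at-cong = λ f≗g → Σ.sum-cong-≗ (λ j → cong (_* x j) (at-cong (φ j) f≗g))
  ; at-+    = λ f g → trans
      (Σ.sum-cong-≗ (λ j → trans (cong (_* x j) (at-+ (φ j) f g)) (ℤ.*-distribʳ-+ (x j) (at (φ j) f) (at (φ j) g))))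
      (Σ.∑-distrib-+ (λ j → at (φ j) f * x j) (λ j → at (φ j) g * x j))
  ; at-*    = λ c f → trans
      (Σ.sum-cong-≗ (λ j → trans (cong (_* x j) (at-* (φ j) c f)) (ℤ.*-assoc c (at (φ j) f) (x j))))
      (sym (Σ.*-distribˡ-sum c (λ j → at (φ j) f * x j)))
  }
  where open Functional

-- Discarding one stray vertex costs at most one entry of a duplicate-free list; `misses` does this
-- four times.
avoid : (S : Subset n) (x : Fin n) {P : Fin n → Set} {zs : List (Fin n)} → Unique zs → All (λ z → z ∈ S ⊕ x × P z) zs →
  ∃ λ zs′ → Unique zs′ × All (λ z → z ∈ S × P z) zs′ × length zs ≤ suc (length zs′)
avoid S x {P} {zs} zs! zs∈ = filter ≢x? zs , Unique.filter⁺ ≢x? zs!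
  , All.zipWith (λ (z≢x , (z∈ , Pz)) → Sum.[ (λ z≡x → contradiction z≡x z≢x) , (λ z∈S → z∈S) ] (∈-⊕⁻ S x z∈) , Pz)
      (All.all-filter ≢x? zs , All.filter⁺ ≢x? zs∈)
  , shorter zs zs!
  where
  ≢x? : ∀ z → Dec (z ≢ x)
  ≢x? z = ¬? (z Fin.≟ x)
  shorter : ∀ zs → Unique zs → length zs ≤ suc (length (filter ≢x? zs))
  shorter [] [] = z≤n
  shorter (z ∷ zs) (z∉zs ∷ zs!) with z Fin.≟ x
  ... | no  _    = s≤s (shorter zs zs!)
  ... | yes refl = s≤s (ℕ.≤-reflexive (cong length (sym (filter-all ≢x? (All.map (λ x≢z z≡x → x≢z (sym z≡x)) z∉zs)))))

lookup-injective : {A : Set} {xs : List A} → Unique xs → ∀ i j → lookup xs i ≡ lookup xs j → i ≡ j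
lookup-injective (_ ∷ _)    zero    zero    _  = refl
lookup-injective (x∉xs ∷ _) zero    (suc j) eq = contradiction eq (All.lookup x∉xs (∈-lookup j))
lookup-injective (x∉xs ∷ _) (suc i) zero    eq = contradiction (sym eq) (All.lookup x∉xs (∈-lookup i))
lookup-injective (_ ∷ u)    (suc i) (suc j) eq = cong suc (lookup-injective u i j eq)

splitting : ∀ a b (j : Fin (a ℕ.+ b)) → (∃ λ i → j ≡ i ↑ˡ b) ⊎ (∃ λ i → j ≡ a ↑ʳ i)
splitting a b j with splitAt a j in eq
... | inj₁ i = inj₁ (i , sym (Fin.splitAt⁻¹-↑ˡ eq))
... | inj₂ i = inj₂ (i , sym (Fin.splitAt⁻¹-↑ʳ eq))

module Independence {n d N} (M : MissingTraces n d)
  (K : Fin N → Subset n)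
  (separated : ∀ {v w} → v ≢ w → ∀ {zs} → Unique zs → All (λ z → z ∈ K v × z ∈ K w) zs → 4 ℕ.+ length zs < d)
  (gadget : ∀ w → Local.Gadget M (K w)) where

  open MissingTraces M
  open Polynomials M
  open Local M

  module Γ (w : Fin N) = Gadget (gadget w)

  module _ {v w : Fin N} (v≢w : v ≢ w) where

    misses : ∀ {X} → Γ.D v ⊆ X → ∣ X ∣ ≤ suc d → Any (Misses X) (Γ.ps w)
    misses {X} D⊆X ∣X∣ with misses-or-hits X (Γ.ps w) (Γ.fresh w)
    ... | inj₁ miss = miss
    ... | inj₂ (zs , zs! , zs∈X , zs∈ps , len) =
      let y , X⊆ = cover
          z₁ , z₁! , z₁∈ , l₁ = avoid (K v ⊕ Γ.u v) y zs! (All.zipWith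
            (λ (z∈X , z∈ps) → ⊕-mono (Γ.D v) (Γ.D⊆ v) (X⊆ z∈X) , All.lookup (Γ.ps⊆ w) z∈ps) (zs∈X , zs∈ps))
          z₂ , z₂! , z₂∈ , l₂ = avoid (K v) (Γ.u v) z₁! z₁∈
          z₃ , z₃! , z₃∈ , l₃ = avoid (K w ⊕ Γ.u w) (Γ.v w) z₂! (All.map (λ (p , q) → q , p) z₂∈)
          z₄ , z₄! , z₄∈ , l₄ = avoid (K w) (Γ.u w) z₃! z₃∈
      in contradiction (separated v≢w z₄! (All.map (λ (p , q) → q , p) z₄∈)) (ℕ.≤⇒≯ (begin
           d                          ≡⟨ trans len (Γ.length-ps w) ⟨
           length zs                  ≤⟨ l₁ ⟩
           1 ℕ.+ length z₁            ≤⟨ s≤s l₂ ⟩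
           2 ℕ.+ length z₂            ≤⟨ s≤s (s≤s l₃) ⟩
           3 ℕ.+ length z₃            ≤⟨ s≤s (s≤s (s≤s l₄)) ⟩
           4 ℕ.+ length z₄            ∎))
      where
      open ℕ.≤-Reasoning
      -- `X` has at most one vertex beyond `D`. If it has none, any vertex can serve as `y`.
      cover : ∃ λ y → X ⊆ Γ.D v ⊕ y
      cover with X ⊆? Γ.D v
      ... | yes X⊆D = Γ.u v , (λ x∈ → ∈-⊕⁺ (Γ.D v) (Γ.u v) (X⊆D x∈))
      ... | no  X⊈D = let y , y∈X , y∉D = ⊈⇒∃ X (Γ.D v) X⊈D in y , λ {x} → subst (x ∈_) (sym (⊆-∣∣-≡
            (⊕-⊆ (Γ.D v) y∈X D⊆X)
            (ℕ.≤-trans ∣X∣ (ℕ.≤-reflexive (sym (trans (∣⊕∣ (Γ.D v) y∉D) (cong suc (Γ.∣D∣ v))))))))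

    -- Each summand of `vanishing` depends only on `D` or on a member containing `D`, and every such
    -- set misses some pair of the other gadget.
    orthogonal : Δ (Γ.ps w) (vanishing (Γ.D v)) ⁅ Γ.c w ⁆ ≡ 0ℤ
    orthogonal = trans (at-vanishing (gadget-functional (Γ.fresh w) (Γ.length-ps w)) (Γ.D v)) (cong₂ _-_
      (Δ-misses (λ a∉D → mono-insert-∉ (Γ.D v) a∉D) (Γ.ps w)
        (misses (λ x∈ → x∈) (ℕ.≤-trans (ℕ.≤-reflexive (Γ.∣D∣ v)) (ℕ.n≤1+n d))) ⁅ Γ.c w ⁆)
      (∑-zero F member))
      where
      member : ∀ {X} → X List.∈ F → mono (Γ.D v) X * Δ (Γ.ps w) (dual X) ⁅ Γ.c w ⁆ ≡ 0ℤ
      member {X} X∈F with Γ.D v ⊆? X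
      ... | no _    = ℤ.*-zeroˡ (Δ (Γ.ps w) (dual X) ⁅ Γ.c w ⁆)
      ... | yes D⊆X = trans (ℤ.*-identityˡ _)
        (Δ-misses (λ a∉X → dual-insert-∉ X∈F a∉X) (Γ.ps w) (misses D⊆X (ℕ.≤-reflexive (size X∈F))) ⁅ Γ.c w ⁆)

  φ′ : Fin (length F) ⊎ Fin N → Functional n (suc d)
  φ′ (inj₁ i) = evaluation (lookup F i) (size (∈-lookup i))
  φ′ (inj₂ w) = gadget-functional (Γ.fresh w) (Γ.length-ps w)

  φ : Fin (length F ℕ.+ N) → Functional n (suc d)
  φ j = φ′ (splitAt (length F) j)

  module _ (x : Fin (length F ℕ.+ N) → ℤ) (kills : Functional.Kills (linearCombination x φ) d) where

    open Functional (linearCombination x φ)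

    low : ∀ T → ∣ T ∣ < d → at (mono T) ≡ 0ℤ
    low T ∣T∣<d = kills-≤ (d ℕ.∸ ∣ T ∣)
      (ℕ.≤-trans (ℕ.≤-reflexive (ℕ.m∸n+n≡m (ℕ.<⇒≤ ∣T∣<d))) (ℕ.n≤1+n d))
      (subst Kills (sym (ℕ.m∸n+n≡m (ℕ.<⇒≤ ∣T∣<d))) kills) T refl

    at-dual≡0 : ∀ {X} → X List.∈ F → at (dual X) ≡ 0ℤ
    at-dual≡0 {X} X∈F = trans (at-dual (linearCombination x φ) low X∈F)
      (∑-zero (rest X) (λ {e} e∈ → kills (X ⊖ e) (ℕ.suc-injective (trans (∣⊖∣ X (proj₁ (∈-rest⁻ X e∈))) (size X∈F)))))

    at-vanishing≡0 : ∀ {D} → ∣ D ∣ ≡ d → at (vanishing D) ≡ 0ℤ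
    at-vanishing≡0 {D} ∣D∣ = trans (at-vanishing (linearCombination x φ) D) (cong₂ _-_ (kills D ∣D∣)
      (∑-zero F (λ {X} X∈F → trans (cong (mono D X *_) (at-dual≡0 X∈F)) (ℤ.*-zeroʳ (mono D X)))))

    -- A test function for the coefficient at `j`: every other term may die through its value or
    -- through its coefficient.
    isolate : ∀ f j → at f ≡ 0ℤ → Functional.at (φ j) f ≢ 0ℤ →
              (∀ i → i ≢ j → Functional.at (φ i) f * x i ≡ 0ℤ) → x j ≡ 0ℤ
    isolate f j at≡0 φ≢0 others with ℤ.i*j≡0⇒i≡0∨j≡0 (Functional.at (φ j) f) (trans (sym (sum-single j others)) at≡0)
    ... | inj₁ φ≡0 = contradiction φ≡0 φ≢0
    ... | inj₂ x≡0 = x≡0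

    φ-ˡ : ∀ i f → Functional.at (φ (i ↑ˡ N)) f ≡ f (lookup F i)
    φ-ˡ i f = cong (λ s → Functional.at (φ′ s) f) (Fin.splitAt-↑ˡ (length F) i N)

    φ-ʳ : ∀ w f → Functional.at (φ (length F ↑ʳ w)) f ≡ Δ (Γ.ps w) f ⁅ Γ.c w ⁆
    φ-ʳ w f = cong (λ s → Functional.at (φ′ s) f) (Fin.splitAt-↑ʳ (length F) N w)

    -- The system is triangular, and the gadget coefficients come first: the test function is zero
    -- on `F` and on all other gadgets.
    x-ʳ : ∀ w → x (length F ↑ʳ w) ≡ 0ℤ
    x-ʳ w = isolate (vanishing (Γ.D w)) (length F ↑ʳ w) (at-vanishing≡0 {Γ.D w} (Γ.∣D∣ w))
      (λ eq → Γ.nonzero w (trans (sym (φ-ʳ w _)) eq)) others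
      where
      others : ∀ i → i ≢ length F ↑ʳ w → Functional.at (φ i) (vanishing (Γ.D w)) * x i ≡ 0ℤ
      others i i≢ with splitting (length F) N i
      ... | inj₁ (k , refl) = trans (cong (_* x i) (trans (φ-ˡ k _) (vanishing-F (Γ.D w) (∈-lookup k)))) (ℤ.*-zeroˡ (x i))
      ... | inj₂ (v , refl) = trans (cong (_* x i) (trans (φ-ʳ v _)
            (orthogonal (λ w≡v → i≢ (cong (length F ↑ʳ_) (sym w≡v)))))) (ℤ.*-zeroˡ (x i))

    -- `dual X` may be nonzero on gadgets, but their coefficients are already known to be 0.
    x-ˡ : ∀ k → x (k ↑ˡ N) ≡ 0ℤ
    x-ˡ k = isolate (dual X) (k ↑ˡ N) (at-dual≡0 (∈-lookup k))
      (λ eq → contradiction (trans (sym (trans (φ-ˡ k _) (dual-self (∈-lookup k)))) eq) λ ()) others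
      where
      X = lookup F k
      others : ∀ i → i ≢ k ↑ˡ N → Functional.at (φ i) (dual X) * x i ≡ 0ℤ
      others i i≢ with splitting (length F) N i
      ... | inj₁ (l , refl) = trans (cong (_* x i) (trans (φ-ˡ l _) (dual-other (∈-lookup k) (∈-lookup l)
            (λ X≡Y → i≢ (cong (_↑ˡ N) (sym (lookup-injective F! k l X≡Y))))))) (ℤ.*-zeroˡ (x i))
      ... | inj₂ (v , refl) = trans (cong (Functional.at (φ i) (dual X) *_) (x-ʳ v)) (ℤ.*-zeroʳ (Functional.at (φ i) (dual X)))

    trivial : ∀ j → x j ≡ 0ℤ
    trivial j with splitting (length F) N j
    ... | inj₁ (k , refl) = x-ˡ k
    ... | inj₂ (w , refl) = x-ʳ w

  -- With more functionals than d-sets, some nontrivial combination kills every monomial of degree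
  -- `d`, against `trivial`.
  bound : length F ℕ.+ N ≤ n C d
  bound = ℕ.≮⇒≥ λ lt →
    let x , (j , xj≢0) , solves = homogeneous-solution
          (λ i j → Functional.at (φ j) (mono (lookup (subsetsOfSize n d) i)))
          (subst (_< length F ℕ.+ N) (sym (length-subsetsOfSize n d)) lt)
    in xj≢0 (trivial x (λ T ∣T∣ → let T∈ = ∈-subsetsOfSize d T ∣T∣ in
         subst (λ S → Functional.at (linearCombination x φ) (mono S) ≡ 0ℤ) (sym (lookup-index T∈)) (solves (Any.index T∈))) j)

-- Assembling the bound

missing-trace : ∀ {n} (F : List (Subset n)) (S : Subset n) → ¬ Shatters F S →
                ∃ λ A → A ⊆ S × All (λ X → X ∩ S ≢ A) F
missing-trace F S ¬shatters with anySubset? (λ A → (A ⊆? S) ×-dec All.all? (λ X → ¬? (≡-dec Bool._≟_ (X ∩ S) A)) F)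
... | yes found = found
... | no  none  = contradiction shatters ¬shatters
  where
  shatters : Shatters F S
  shatters A A⊆S with Any.any? (λ X → ≡-dec Bool._≟_ (X ∩ S) A) F
  ... | yes some = find some
  ... | no ¬some = contradiction (A , (λ {x} → A⊆S {x}) , All.¬Any⇒All¬ F ¬some) none

missingTraces : ∀ {n d} (F : Family n (suc d)) → vcDim (members F) ≤ d → MissingTraces n d
missingTraces {n} {d} F vc≤d = record
  { F       = members F
  ; F!      = unique F
  ; size    = All.lookup (uniform F)
  ; B       = B
  ; B⊆      = λ X∈F → proj₁ (B-missing X∈F)
  ; missing = λ X∈F Y∈F → All.lookup (proj₂ (B-missing X∈F)) Y∈F
  }
  where
  MissingFrom : Subset n → Subset n → Set
  MissingFrom X A = A ⊆ X × All (λ Y → Y ∩ X ≢ A) (members F)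
  choose : ∀ X → Dec (Shatters (members F) X) → Subset n
  -- A default value: a member of `F` has d + 1 vertices, so the bound on the VC-dimension excludes
  -- this case for it.
  choose X (yes _) = Sub.⊥
  choose X (no ¬s) = proj₁ (missing-trace (members F) X ¬s)
  B : Subset n → Subset n
  B X = choose X (shatters? (members F) X)
  B-missing : ∀ {X} → X List.∈ members F → MissingFrom X (B X)
  B-missing {X} X∈F = chosen (shatters? (members F) X)
    where
    chosen : ∀ s? → MissingFrom X (choose X s?)
    chosen (no ¬s) = proj₂ (missing-trace (members F) X ¬s)
    chosen (yes s) = contradiction
      (ℕ.≤-trans (ℕ.≤-reflexive (sym (All.lookup (uniform F) X∈F))) (ℕ.≤-trans (shattered⇒≤vcDim (members F) X s) vc≤d))
      (ℕ.<⇒≱ (ℕ.n<1+n d))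

-- Nearly disjoint blocks from the code

module Code {n m r q : ℕ} (0<q : 0 < q) (fits : m ℕ.* (q ℕ.* height m r) ≤ n) where

  point : Fin (q ^ r) → Fin m → Fin n
  point w i = inject≤ (vertex {m} {r} 0<q w i) fits

  point-injective : ∀ v w {i j} → point v i ≡ point w j → vertex {m} {r} 0<q v i ≡ vertex {m} {r} 0<q w j
  point-injective v w = Fin.inject≤-injective fits fits _ _

  points : Fin (q ^ r) → List (Fin n)
  points w = tabulate (point w)

  block : Fin (q ^ r) → Subset n
  block w = Sub.⊥ ⊕* points w

  ∣block∣ : ∀ w → ∣ block w ∣ ≡ m
  ∣block∣ w = trans (∣⊕*∣ Sub.⊥ (Unique.tabulate⁺ (λ eq → vertex-injective {m} {r} 0<q w w (point-injective w w eq)))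
      (All.tabulate (λ _ → ∉⊥)))
    (cong₂ ℕ._+_ (∣⊥∣≡0 n) (length-tabulate (point w)))

  ∈-block⁻ : ∀ w {z} → z ∈ block w → ∃ λ i → z ≡ point w i
  ∈-block⁻ w z∈ = Sum.[ (λ z∈⊥ → contradiction z∈⊥ ∉⊥) , ∈-tabulate⁻ ] (∈-⊕*⁻ Sub.⊥ (points w) z∈)

  -- A vertex determines its index, so two blocks can share a vertex only at the same index.
  common-indices : ∀ v w {zs} → Unique zs → All (λ z → z ∈ block v × z ∈ block w) zs →
    ∃ λ is → Unique is × All (λ i → vertex {m} {r} 0<q v i ≡ vertex {m} {r} 0<q w i) is
           × All (λ i → point v i List.∈ zs) is × length is ≡ length zs
  common-indices v w {[]} _ _ = [] , [] , [] , [] , refl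
  common-indices v w {z ∷ zs} (z∉zs ∷ zs!) ((z∈v , z∈w) ∷ zs∈)
    with ∈-block⁻ v z∈v | ∈-block⁻ w z∈w | common-indices v w zs! zs∈
  ... | i , refl | j , eq | is , is! , agree , is∈ , len = i ∷ is
      , All.map (λ k∈zs i≡k → All.lookup z∉zs k∈zs (cong (point v) i≡k)) is∈ ∷ is!
      , trans vᵢ≡wⱼ (cong (vertex {m} {r} 0<q w) (sym (vertex-injective {m} {r} 0<q v w vᵢ≡wⱼ))) ∷ agree
      , here refl ∷ All.map there is∈ , cong suc len
    where
    vᵢ≡wⱼ : vertex {m} {r} 0<q v i ≡ vertex {m} {r} 0<q w j
    vᵢ≡wⱼ = point-injective v w eq

  block-separated : ∀ {v w} → v ≢ w → ∀ {zs} → Unique zs → All (λ z → z ∈ block v × z ∈ block w) zs → length zs < r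
  block-separated {v} {w} v≢w zs! zs∈ with common-indices v w zs! zs∈
  ... | is , is! , agree , _ , len = ℕ.≰⇒> λ r≤ →
    v≢w (vertex-agree {m} {r} 0<q v w is! (ℕ.≤-trans r≤ (ℕ.≤-reflexive (sym len))) agree)

-- Double-negation shift over a finite index set. `NoGadget` only refutes the absence of a gadget;
-- this suffices because the final inequality is decidable.
¬¬-Fin : ∀ {N} {P : Fin N → Set} → (∀ i → ¬ ¬ P i) → ¬ ¬ (∀ i → P i)
¬¬-Fin {zero}  ¬¬P ¬∀ = ¬∀ λ ()
¬¬-Fin {suc N} ¬¬P ¬∀ = ¬¬P zero λ p → ¬¬-Fin (¬¬P ∘ suc) λ ps → ¬∀ λ { zero → p ; (suc i) → ps i }

-- At most d + 3 vertices are avoided (`D`, `y`, `z` and `c`), and at most d + 1 are chosen at a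
-- time, as partners in a matching or as replacements for vertices of a member.
blockSize : ℕ → ℕ
blockSize d = 3 ℕ.+ d ℕ.+ suc d

card-bound : ∀ {n} r q → 0 < q → (let d = 4 ℕ.+ r in blockSize d ℕ.* (q ℕ.* height (blockSize d) r) ≤ n) →
  (F : Family n (5 ℕ.+ r)) → vcDim (members F) ≤ 4 ℕ.+ r → card F ℕ.+ q ^ r ≤ n C (4 ℕ.+ r)
card-bound {n} r q 0<q fits F vc≤d = decidable-stable (_ ℕ.≤? _) λ ≰ →
  ¬¬-Fin (λ w noGadget → NoGadget.impossible M (s≤s z≤n) (block w) (ℕ.≤-reflexive (sym (∣block∣ w))) noGadget)
    λ gadget → ≰ (Independence.bound M block (λ v≢w zs! zs∈ → ℕ.+-monoʳ-< 4 (block-separated v≢w zs! zs∈)) gadget)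
  where
  M = missingTraces F vc≤d
  open Code {n} {blockSize (4 ℕ.+ r)} {r} {q} 0<q fits

-- Passage to the rational inequality

toℚᵘ-fromℕ : ∀ m → ℚ.toℚᵘ (fromℕ m) ℚᵘ.≃ mkℚᵘ (+ m) 0
toℚᵘ-fromℕ m = ℚ.toℚᵘ-fromℚᵘ (mkℚᵘ (+ m) 0)

fromℕ-+ : ∀ a b → fromℕ (a ℕ.+ b) ≡ fromℕ a ℚ.+ fromℕ b
fromℕ-+ a b = ℚ.toℚᵘ-injective (begin
  ℚ.toℚᵘ (fromℕ (a ℕ.+ b))                   ≈⟨ toℚᵘ-fromℕ (a ℕ.+ b) ⟩
  mkℚᵘ (+ (a ℕ.+ b)) 0                       ≈⟨ *≡* (cong (_* 1ℤ) (sym (cong₂ _+_ (ℤ.*-identityʳ (+ a)) (ℤ.*-identityʳ (+ b))))) ⟩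
  mkℚᵘ (+ a) 0 ℚᵘ.+ mkℚᵘ (+ b) 0             ≈⟨ ℚᵘ.+-cong (toℚᵘ-fromℕ a) (toℚᵘ-fromℕ b) ⟨
  ℚ.toℚᵘ (fromℕ a) ℚᵘ.+ ℚ.toℚᵘ (fromℕ b)     ≈⟨ ℚ.toℚᵘ-homo-+ (fromℕ a) (fromℕ b) ⟨
  ℚ.toℚᵘ (fromℕ a ℚ.+ fromℕ b)               ∎)
  where open ℚᵘ.≃-Reasoning

fromℕ-* : ∀ a b → fromℕ (a ℕ.* b) ≡ fromℕ a ℚ.* fromℕ b
fromℕ-* a b = ℚ.toℚᵘ-injective (begin
  ℚ.toℚᵘ (fromℕ (a ℕ.* b))                   ≈⟨ toℚᵘ-fromℕ (a ℕ.* b) ⟩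
  mkℚᵘ (+ (a ℕ.* b)) 0                       ≈⟨ *≡* (cong (_* 1ℤ) (ℤ.pos-* a b)) ⟩
  mkℚᵘ (+ a) 0 ℚᵘ.* mkℚᵘ (+ b) 0             ≈⟨ ℚᵘ.*-cong (toℚᵘ-fromℕ a) (toℚᵘ-fromℕ b) ⟨
  ℚ.toℚᵘ (fromℕ a) ℚᵘ.* ℚ.toℚᵘ (fromℕ b)     ≈⟨ ℚ.toℚᵘ-homo-* (fromℕ a) (fromℕ b) ⟨
  ℚ.toℚᵘ (fromℕ a ℚ.* fromℕ b)               ∎)
  where open ℚᵘ.≃-Reasoning

fromℕ-mono-≤ : ∀ {a b} → a ≤ b → fromℕ a ℚ.≤ fromℕ b
fromℕ-mono-≤ {a} {b} a≤b = ℚ.toℚᵘ-cancel-≤ (begin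
  ℚ.toℚᵘ (fromℕ a)  ≃⟨ toℚᵘ-fromℕ a ⟩
  mkℚᵘ (+ a) 0      ≤⟨ *≤* (ℤ.*-monoʳ-≤-nonNeg 1ℤ (ℤ.+≤+ a≤b)) ⟩
  mkℚᵘ (+ b) 0      ≃⟨ toℚᵘ-fromℕ b ⟨
  ℚ.toℚᵘ (fromℕ b)  ∎)
  where open ℚᵘ.≤-Reasoning

≤-minus : ∀ {p q s} → p ℚ.+ q ℚ.≤ s → p ℚ.≤ s ℚ.- q
≤-minus {p} {q} {s} p+q≤s = ℚ.≤-trans (ℚ.≤-reflexive (sym (begin
  (p ℚ.+ q) ℚ.- q       ≡⟨ ℚ.+-assoc p q (ℚ.- q) ⟩
  p ℚ.+ (q ℚ.- q)       ≡⟨ cong (p ℚ.+_) (ℚ.+-inverseʳ q) ⟩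
  p ℚ.+ 0ℚ              ≡⟨ ℚ.+-identityʳ p ⟩
  p                     ∎))) (ℚ.+-monoˡ-≤ (ℚ.- q) p+q≤s)
  where open ≡-Reasoning

^-distribʳ-* : ∀ r a b → (a ℕ.* b) ^ r ≡ a ^ r ℕ.* b ^ r
^-distribʳ-* zero    a b = refl
^-distribʳ-* (suc r) a b = trans (cong (a ℕ.* b ℕ.*_) (^-distribʳ-* r a b)) (ℕ.[m*n]*[o*p]≡[m*o]*[n*p] a b (a ^ r) (b ^ r))

theorem4p1 : (d : ℕ) → 4 ≤ d →
    ∃ λ (c : ℚ) → 0ℚ ℚ.< c ×
    ∃ λ (n₀ : ℕ) → (n : ℕ) → n₀ ≤ n →
    (F : Family n (suc d)) → vcDim (members F) ≤ d →
    fromℕ (card F) ℚ.≤ fromℕ (n C d) ℚ.- c ℚ.* fromℕ (n ^ (d ∸ 4))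
theorem4p1 _ (s≤s (s≤s (s≤s (s≤s (z≤n {r}))))) = c , 0<c , unit , bound
  where
  d = 4 ℕ.+ r
  h = height (blockSize d) r
  height-suc : ∀ m r → ∃ λ k → height m r ≡ suc k
  height-suc m zero    = 0 , refl
  height-suc m (suc r) = m ℕ.* height m r , refl
  -- The code with parameter q occupies `unit` times q vertices.
  unit = blockSize d ℕ.* h
  0<unit : 0 < unit
  0<unit = subst (λ h → 0 < blockSize d ℕ.* h) (sym (proj₂ (height-suc (blockSize d) r))) (s≤s z≤n)
  instance
    unit≢0 : ℕ.NonZero unit
    unit≢0 = ℕ.>-nonZero 0<unit
  -- For n ≥ `unit` the quotient q = n / unit is positive, so rounding down loses at most a factor
  -- 2: n ≤ 2 · unit · q, and n^r ≤ C₀ · q^r.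
  C₀ = (2 ℕ.* unit) ^ r
  0<C₀ : 0 < C₀
  0<C₀ = ℕ.m^n>0 (2 ℕ.* unit) ⦃ ℕ.m*n≢0 2 unit ⦄ r
  instance
    C₀-positive : ℚ.Positive (fromℕ C₀)
    C₀-positive = ℚ.positive (ℚ.<-≤-trans (ℚ.*<* (ℤ.+<+ (s≤s z≤n))) (fromℕ-mono-≤ 0<C₀))
    C₀-nonZero : ℚ.NonZero (fromℕ C₀)
    C₀-nonZero = ℚ.pos⇒nonZero (fromℕ C₀)
  c : ℚ
  c = ℚ.1/ fromℕ C₀
  c-positive : ℚ.Positive c
  c-positive = ℚ.1/pos⇒pos (fromℕ C₀)
  0<c : 0ℚ ℚ.< c
  0<c = ℚ.positive⁻¹ c ⦃ c-positive ⦄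
  bound : ∀ n → unit ≤ n → (F : Family n (suc d)) → vcDim (members F) ≤ d →
    fromℕ (card F) ℚ.≤ fromℕ (n C d) ℚ.- c ℚ.* fromℕ (n ^ r)
  bound n unit≤n F vc≤d = ≤-minus (begin
    fromℕ (card F) ℚ.+ c ℚ.* fromℕ (n ^ r)  ≤⟨ ℚ.+-monoʳ-≤ (fromℕ (card F)) few ⟩
    fromℕ (card F) ℚ.+ fromℕ (q ^ r)        ≡⟨ fromℕ-+ (card F) (q ^ r) ⟨
    fromℕ (card F ℕ.+ q ^ r)                ≤⟨ fromℕ-mono-≤ (card-bound r q 0<q fits F vc≤d) ⟩
    fromℕ (n C d)                           ∎)
    where
    open ℚ.≤-Reasoning
    q = n / unit
    0<q : 0 < q
    0<q = m≥n⇒m/n>0 unit≤n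
    fits : blockSize d ℕ.* (q ℕ.* h) ≤ n
    fits = ℕ.≤-trans (ℕ.≤-reflexive (trans (cong (blockSize d ℕ.*_) (ℕ.*-comm q h))
      (trans (sym (ℕ.*-assoc (blockSize d) h q)) (ℕ.*-comm unit q)))) (m/n*n≤m n unit)
    n≤2qu : n ≤ 2 ℕ.* unit ℕ.* q
    n≤2qu = ℕ.≤-trans (ℕ.≤-reflexive (m≡m%n+[m/n]*n n unit)) (ℕ.≤-trans
      (ℕ.+-monoˡ-≤ (q ℕ.* unit) (ℕ.≤-trans (ℕ.<⇒≤ (m%n<n n unit)) (ℕ.m≤n*m unit q ⦃ ℕ.>-nonZero 0<q ⦄)))
      (ℕ.≤-reflexive (trans (cong (λ t → q ℕ.* unit ℕ.+ t) (sym (ℕ.+-identityʳ (q ℕ.* unit))))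
        (trans (cong (2 ℕ.*_) (ℕ.*-comm q unit)) (sym (ℕ.*-assoc 2 unit q))))))
    few : c ℚ.* fromℕ (n ^ r) ℚ.≤ fromℕ (q ^ r)
    few = begin
      c ℚ.* fromℕ (n ^ r)              ≤⟨ ℚ.*-monoˡ-≤-nonNeg c ⦃ ℚ.pos⇒nonNeg c ⦃ c-positive ⦄ ⦄ (fromℕ-mono-≤ (ℕ.^-monoˡ-≤ r n≤2qu)) ⟩
      c ℚ.* fromℕ ((2 ℕ.* unit ℕ.* q) ^ r) ≡⟨ cong (λ t → c ℚ.* fromℕ t) (^-distribʳ-* r (2 ℕ.* unit) q) ⟩
      c ℚ.* fromℕ (C₀ ℕ.* q ^ r)       ≡⟨ cong (c ℚ.*_) (fromℕ-* C₀ (q ^ r)) ⟩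
      c ℚ.* (fromℕ C₀ ℚ.* fromℕ (q ^ r)) ≡⟨ ℚ.*-assoc c (fromℕ C₀) (fromℕ (q ^ r)) ⟨
      c ℚ.* fromℕ C₀ ℚ.* fromℕ (q ^ r) ≡⟨ cong (ℚ._* fromℕ (q ^ r)) (ℚ.*-inverseˡ (fromℕ C₀)) ⟩
      1ℚ ℚ.* fromℕ (q ^ r)             ≡⟨ ℚ.*-identityˡ (fromℕ (q ^ r)) ⟩
      fromℕ (q ^ r)                    ∎
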